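{- For every $n\ge1$, the map $f\colon\mathcal{T}_n(P,e)\to\mathcal{M}'_{n-1}(Z)$ is a bijection in each of the following four cases: (i) $(P,e)=(2134,111)$, $Z=\{\mathtt{U}\mathtt{U},\mathtt{U}\mathtt{F}_R\}$; (ii) $(P,e)=(3214,111)$, $Z=\{\mathtt{D}\mathtt{U},\mathtt{D}\mathtt{F}_L\}$; (iii) $(P,e)=(1324,111)$, $Z=\{\mathtt{U}\mathtt{U},\mathtt{F}_R\mathtt{U}\}$; (iv) $(P,e)=(1243,111)$, $Z=\{\mathtt{U},\mathtt{F}_R\}\times\{\mathtt{U},\mathtt{F}_R\}\times\{\mathtt{U},\mathtt{F}_L\}$ (all 8 three-letter words $xyz$ with $x,y\in\{\mathtt U,\mathtt F_R\}$, $z\in\{\mathtt U,\mathtt F_L\}$). Moreover, $(2134,111)=(2134,\text{ - }1\text{ - })$, $(3214,111)=(3214,1\text{ - }\text{ - })$, $(1324,111)=(1324,1\text{ - }\text{ - })$ and $(1243,111)=(1243,1\text{ - }\text{ - })$ in the sense that the set of avoiding trees does not change when the entries marked "-" are replaced by arbitrary values in $\{0,1\}$. Furthermore, for each $n\ge1$ these four sets of Motzkin paths have the same cardinality, and these cardinalities form the sequence OEIS A025242, whose terms for $n=1,2,3,\dots$ are $1,2,5,13,35,97,275,794,2327,6905,\dots$.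
   Context: $\mathcal{T}_n$ is the set of binary trees on $n$ vertices labeled $1,\dots,n$ by the search tree property; $r(T)$ root, $L(T),R(T)$ the left and right subtrees of the root, $c_L,c_R,p$ left child, right child, parent. A tree pattern is $(P,e)$, $P\in\mathcal{T}_k$, $e\colon[k]\setminus\{r(P)\}\to\{0,1\}$; $T$ contains $(P,e)$ if there is an injection $f\colon[k]\to[n]$ such that for each non-root $i$ of $P$: if $e(i)=1$, $f(i)$ is the left (resp. right) child of $f(p(i))$ when $i$ is the left (resp. right) child of $p(i)$; if $e(i)=0$, $f(i)$ lies in the left (resp. right) subtree of $f(p(i))$. $\mathcal{T}_n(P,e)$ is the set of avoiders. Compact notation: $(\tau_1\cdots\tau_k,\,x_2\cdots x_k)$ denotes the pattern $(P,e)$ whose preorder sequence (root, then recursively left subtree, then right subtree) is $\tau_1,\dots,\tau_k$ and with $e(\tau_j)=x_j$. Motzkin paths with 2-colored flat steps: words over $\{\mathtt U,\mathtt D,\mathtt F_L,\mathtt F_R\}$ where $\mathtt U=(1,1)$, $\mathtt D=(1,-1)$, $\mathtt F_L,\mathtt F_R=(1,0)$, starting at $(0,0)$, ending on the $x$-axis, never going below it; $\mathcal{M}'_m$ is the set of such paths with $m$ steps, and $\mathcal{M}'_m(Z)$ those containing no word of $Z$ as a consecutive substring. The map $f$ on nonempty binary trees: if $r(T)$ has no children, $f(T)$ is the empty path; if it has only a left child, $f(T)=\mathtt F_L\,f(L(T))$; if only a right child, $f(T)=\mathtt F_R\,f(R(T))$; if two children, $f(T)=\mathtt U\,f(R(T))\,\mathtt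 D\,f(L(T))$. -}

module Defs where

open import Data.Bool.Base using (Bool; true; false; if_then_else_)
open import Data.Fin.Base using (Fin; zero; suc; toℕ; _<_)
open import Data.Fin.Properties using (_≟_)
open import Data.List.Base using (List; []; _∷_; [_]; _++_; map; drop; head; take; length; reverse; zipWith; applyUpTo; cartesianProductWith)
open import Data.List.Relation.Unary.All as List using ()
open import Data.List.Relation.Binary.Infix.Heterogeneous using (Infix)
open import Data.Maybe.Base using (fromMaybe)
open import Data.Nat.Base using (ℕ; zero; suc; pred; _*_; _∸_; z<s; s<s)
open import Data.Nat.ListAction using (sum)
open import Data.Product.Base using (Σ; Σ-syntax; ∃-syntax; _×_; proj₁)
open import Data.Tree.Binary using (Tree; leaf; node; #nodes; module Prefix)
open import Data.Tree.Binary.Relation.Unary.All as Tree using (leaf; node)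
open import Data.Unit.Base using (⊤; tt)
open import Function.Base using (_∘_)
open import Function.Bundles using (Bijection)
open import Function.Definitions using (Injective)
open import Level using (0ℓ)
open import Relation.Binary.Bundles using (Setoid)
import Relation.Binary.Construct.On as On
open import Relation.Binary.PropositionalEquality using (_≡_; refl; setoid)
open import Relation.Nullary using (¬_; does)
open import Relation.Unary using (Pred)

-- The vertex set [n] = {1,…,n} is Fin n, the vertex i + 1 being the i-th
-- element of Fin n.

BinTree : ℕ → Set
BinTree n = Tree (Fin n) ⊤

pattern nil = leaf tt

AllVertices : ∀ {n} → Pred (Fin n) 0ℓ → Pred (BinTree n) 0ℓ
AllVertices Q = Tree.All Q (λ _ → ⊤)

data SearchTree {n} : BinTree n → Set where
  leaf : SearchTree nil
  node : ∀ {l x r} →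
         AllVertices (_< x) l → AllVertices (x <_) r →
         SearchTree l → SearchTree r → SearchTree (node l x r)

-- The search tree property makes the labels distinct, so n vertices with
-- labels in Fin n use every label exactly once.

record 𝒯 (n : ℕ) : Set where
  constructor mk𝒯
  field
    tree   : BinTree n
    size   : #nodes tree ≡ n
    search : SearchTree tree

open 𝒯 public

-- S ⊑ T: S is the subtree of T rooted at some vertex of T, or an empty
-- subtree.

data _⊑_ {n} (S : BinTree n) : BinTree n → Set where
  here  : S ⊑ S
  left  : ∀ {l x r} → S ⊑ l → S ⊑ node l x r
  right : ∀ {l x r} → S ⊑ r → S ⊑ node l x r

data IsRoot {n} (i : Fin n) : BinTree n → Set where
  root : ∀ {l r} → IsRoot i (node l i r)

_∈_ : ∀ {n} → Fin n → BinTree n → Set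
i ∈ T = ∃[ S ] S ⊑ T × IsRoot i S

data Side : Set where
  left right : Side

-- SubtreeOf T s i S: the s-subtree of the vertex i of T is S.

data SubtreeOf {n} (T : BinTree n) : Side → Fin n → BinTree n → Set where
  left  : ∀ {l i r} → node l i r ⊑ T → SubtreeOf T left  i l
  right : ∀ {l i r} → node l i r ⊑ T → SubtreeOf T right i r

-- Child T s i j: j is the s-child of i in T.

Child : ∀ {n} → BinTree n → Side → Fin n → Fin n → Set
Child T s i j = ∃[ S ] SubtreeOf T s i S × IsRoot j S

-- InSubtree T s i j: j lies in the s-subtree of i in T.

InSubtree : ∀ {n} → BinTree n → Side → Fin n → Fin n → Set
InSubtree T s i j = ∃[ S ] SubtreeOf T s i S × j ∈ S

-- The edge labels 1 and 0 are true and false.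

record Pattern (k : ℕ) : Set where
  field
    P : 𝒯 k
    e : (i : Fin k) → .(¬ IsRoot i (tree P)) → Bool

Edge : Bool → ∀ {n} → BinTree n → Side → Fin n → Fin n → Set
Edge true  = Child
Edge false = InSubtree

-- In the last component p is the parent of the non-root vertex i.

Contains : ∀ {n k} → 𝒯 n → Pattern k → Set
Contains {n} {k} T pat =
  Σ[ φ ∈ (Fin k → Fin n) ]
    Injective _≡_ _≡_ φ ×
    (∀ i (nonroot : ¬ IsRoot i (tree P)) s p → Child (tree P) s p i →
       Edge (e i nonroot) (tree T) s (φ p) (φ i))
  where open Pattern pat

Avoids : ∀ {k} n → Pattern k → Pred (𝒯 n) 0ℓ
Avoids n pat T = ¬ Contains T pat

-- 𝒯ₙ(P,e); trees are compared by their underlying labelled trees, ignoring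
-- the attached proofs.

avoiders : ∀ {k} (n : ℕ) → Pattern k → Setoid 0ℓ 0ℓ
avoiders n pat = On.setoid {B = Σ (𝒯 n) (Avoids n pat)} (setoid (BinTree n)) (tree ∘ proj₁)

preorder : ∀ {n} → 𝒯 n → List (Fin n)
preorder = Prefix.toList ∘ tree

-- The entry of the second list at the position of i in the first; the
-- default false is never reached for a non-root vertex and enough entries.

entryAt : ∀ {k} → Fin k → List (Fin k) → List Bool → Bool
entryAt i (j ∷ js) (x ∷ xs) = if does (i ≟ j) then x else entryAt i js xs
entryAt _ _        _        = false

-- ⟨ P ∣ x₂ ⋯ xₖ ⟩ is (τ₁⋯τₖ, x₂⋯xₖ) for τ₁⋯τₖ the preorder sequence of P.

⟨_∣_⟩ : ∀ {k} → 𝒯 k → List Bool → Pattern k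
⟨ P ∣ xs ⟩ = record { P = P ; e = λ i _ → entryAt i (drop 1 (preorder P)) xs }

pattern v₁ = zero
pattern v₂ = suc zero
pattern v₃ = suc (suc zero)
pattern v₄ = suc (suc (suc zero))

private
  pattern vertex x = node nil x nil
  pattern none = Tree.leaf tt
  pattern single = node none none leaf leaf

P2134 P3214 P1324 P1243 : 𝒯 4

P2134 = mk𝒯 (node (vertex v₁) v₂ (node nil v₃ (vertex v₄))) refl
  (node (node none z<s none)
        (node none (s<s z<s) (node none (s<s z<s) none))
        single
        (node none (node none (s<s (s<s z<s)) none) leaf single))

P3214 = mk𝒯 (node (node (vertex v₁) v₂ nil) v₃ (vertex v₄)) refl
  (node (node (node none z<s none) (s<s z<s) none)
        (node none (s<s (s<s z<s)) none)
        (node (node none z<s none) none single leaf)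
        single)

P1324 = mk𝒯 (node nil v₁ (node (vertex v₂) v₃ (vertex v₄))) refl
  (node none
        (node (node none z<s none) z<s (node none z<s none))
        leaf
        (node (node none (s<s z<s) none) (node none (s<s (s<s z<s)) none) single single))

P1243 = mk𝒯 (node nil v₁ (node nil v₂ (node (vertex v₃) v₄ nil))) refl
  (node none
        (node none z<s (node (node none z<s none) z<s none))
        leaf
        (node none
              (node (node none (s<s z<s) none) (s<s z<s) none)
              leaf
              (node (node none (s<s (s<s z<s)) none) none single leaf)))

private
  word : 𝒯 4 → List ℕ
  word = map (suc ∘ toℕ) ∘ preorder

  _ : word P2134 ≡ 2 ∷ 1 ∷ 3 ∷ 4 ∷ []
  _ = refl

  _ : word P3214 ≡ 3 ∷ 2 ∷ 1 ∷ 4 ∷ []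
  _ = refl

  _ : word P1324 ≡ 1 ∷ 3 ∷ 2 ∷ 4 ∷ []
  _ = refl

  _ : word P1243 ≡ 1 ∷ 2 ∷ 4 ∷ 3 ∷ []
  _ = refl

data Step : Set where
  U D FL FR : Step

-- MotzkinFrom h w: the lattice path w started at height h ends on the x-axis
-- and never goes below it.

data MotzkinFrom : ℕ → List Step → Set where
  end   : MotzkinFrom 0 []
  up    : ∀ {h w} → MotzkinFrom (suc h) w → MotzkinFrom h (U ∷ w)
  down  : ∀ {h w} → MotzkinFrom h w → MotzkinFrom (suc h) (D ∷ w)
  flatL : ∀ {h w} → MotzkinFrom h w → MotzkinFrom h (FL ∷ w)
  flatR : ∀ {h w} → MotzkinFrom h w → MotzkinFrom h (FR ∷ w)

record ℳ′ (m : ℕ) (Z : List (List Step)) : Set where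
  field
    path    : List Step
    steps   : length path ≡ m
    motzkin : MotzkinFrom 0 path
    avoids  : List.All (λ z → ¬ Infix _≡_ z path) Z

open ℳ′ public using (path)

paths : ℕ → List (List Step) → Setoid 0ℓ 0ℓ
paths m Z = On.setoid {B = ℳ′ m Z} (setoid (List Step)) path

-- The value on the empty tree is a dummy: f is only meant for nonempty trees.

f : ∀ {n} → BinTree n → List Step
f nil                                    = []
f (node nil            _ nil)            = []
f (node l@(node _ _ _) _ nil)            = FL ∷ f l
f (node nil            _ r@(node _ _ _)) = FR ∷ f r
f (node l@(node _ _ _) _ r@(node _ _ _)) = U ∷ f r ++ D ∷ f l

-- f restricts to a bijection 𝒯ₙ(P,e) → ℳ′ₙ₋₁(Z).

f-Bijection : ∀ {k} (n : ℕ) → Pattern k → List (List Step) → Set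
f-Bijection n pat Z =
  Σ[ F ∈ Bijection (avoiders n pat) (paths (pred n) Z) ]
    (∀ T → path (Bijection.to F T) ≡ f (tree (proj₁ T)))

HasCardinality : Setoid 0ℓ 0ℓ → ℕ → Set
HasCardinality S c = Bijection (setoid (Fin c)) S

Z₁ Z₂ Z₃ Z₄ : List (List Step)
Z₁ = (U ∷ U ∷ []) ∷ (U ∷ FR ∷ []) ∷ []
Z₂ = (D ∷ U ∷ []) ∷ (D ∷ FL ∷ []) ∷ []
Z₃ = (U ∷ U ∷ []) ∷ (FR ∷ U ∷ []) ∷ []
Z₄ = cartesianProductWith _∷_ (U ∷ FR ∷ [])
       (cartesianProductWith _∷_ (U ∷ FR ∷ []) (map [_] (U ∷ FL ∷ [])))

-- OEIS A025242 (offset 1): a(1) = 2, a(2) = a(3) = 1 and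
-- a(m) = a(1) a(m-1) + a(2) a(m-2) + ⋯ + a(m-3) a(3) for m ≥ 4.
-- A025242-upTo m is the list a(m+3), a(m+2), …, a(1).

A025242-upTo : ℕ → List ℕ
A025242-upTo zero    = 1 ∷ 1 ∷ 2 ∷ []
A025242-upTo (suc m) = sum (zipWith _*_ (reverse as) (take (length as ∸ 2) as)) ∷ as
  where as = A025242-upTo m

-- The value at 0, outside the sequence, is a dummy.

A025242 : ℕ → ℕ
A025242 0 = 0
A025242 1 = 2
A025242 2 = 1
A025242 (suc (suc (suc m))) = fromMaybe 0 (head (A025242-upTo m))

private
  _ : applyUpTo (A025242 ∘ suc) 12 ≡ 2 ∷ 1 ∷ 1 ∷ 2 ∷ 5 ∷ 13 ∷ 35 ∷ 97 ∷ 275 ∷ 794 ∷ 2327 ∷ 6905 ∷ []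
  _ = refl

{-# OPTIONS --safe #-}
module Submission where

-- f only depends on the unlabelled shape of a tree, and shapes correspond to
-- Motzkin paths and, with the labels forced by the search property, to the trees
-- in 𝒯ₙ.  Every letter of f T belongs to an edge of T and is followed by the
-- word of the subtree below this edge, so containing the tree pattern and
-- containing a word of Z are the same condition on some edge and the top of the
-- subtree below it.  The shapes satisfying the condition everywhere are counted
-- by a generating function C with C = x + 2 x C + x² C + x² C², which is the
-- recurrence of A025242: in cases (i) and (ii) this is the decomposition at the
-- root, and in cases (iii) and (iv) it follows by a rearrangement of the system
-- for the shapes and for those allowed as right subtrees.

open import Defs
open import Data.Bool.Base using (Bool; true; false; T; not; _∧_)
open import Data.Bool.Properties using (T-∧)
open import Data.Empty using (⊥-elim)
open import Data.Fin.Base as Fin using (Fin; zero; suc; toℕ; fromℕ<)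
open import Data.Fin.Properties using (<-cmp; toℕ-injective; toℕ-fromℕ<; toℕ<n; +↔⊎; *↔×)
open import Data.List.Base using (List; []; _∷_; _++_; length; foldr; applyUpTo; applyDownFrom; reverse; take; zipWith)
open import Data.List.Properties using (++-assoc; ++-identityʳ; length-++; length-applyDownFrom; reverse-applyDownFrom; ∷-injectiveˡ)
open import Data.List.Relation.Binary.Infix.Heterogeneous using (Infix; here; there)
open import Data.List.Relation.Binary.Prefix.Heterogeneous using (Prefix)
open import Data.List.Relation.Binary.Prefix.Heterogeneous.Properties using (prefix?)
open import Data.List.Relation.Unary.All as All using (All; all?)
open import Data.Maybe.Base using (Maybe; just; nothing)
open import Data.Maybe.Properties using (just-injective)
open import Data.Nat.Base using (ℕ; zero; suc; _+_; _*_; _∸_; _≤_; _<_; z≤n; s≤s; pred)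
open import Data.Nat.Induction using (<-rec)
open import Data.Nat.ListAction using (sum)
open import Data.Nat.Properties as ℕ using (≤-refl; ≤-trans; ≤-antisym; ≤-reflexive; <-irrefl; <-trans; +-suc; +-comm; +-assoc; +-identityʳ; m≤m+n; m≤n+m; suc-injective)
open import Data.Nat.Tactic.RingSolver using (solve-∀)
open import Data.Product.Base using (Σ; Σ-syntax; ∃₂; ∃-syntax; _×_; _,_; proj₁; proj₂)
open import Data.Product.Function.Dependent.Propositional as Σ using ()
open import Data.Product.Function.NonDependent.Propositional using (_×-↔_)
open import Data.Sum.Base using (_⊎_; inj₁; inj₂)
open import Data.Sum.Function.Propositional using (_⊎-↔_)
open import Data.Tree.Binary using (leaf; node; #nodes)
open import Data.Tree.Binary.Relation.Unary.All as Tree using (leaf; node)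
open import Data.Unit.Base using (⊤; tt)
open import Data.Vec.Base using (Vec; []; _∷_)
open import Function.Base using (_∘_; id)
open import Function.Bundles using (_↔_; Inverse; mk↔ₛ′; _⇔_; mk⇔; Equivalence)
open import Function.Definitions using (Injective)
open import Function.Properties.Inverse using (↔-refl; ↔-trans)
open import Relation.Binary.Definitions using (DecidableEquality; tri<; tri≈; tri>)
open import Relation.Binary.PropositionalEquality using (_≡_; refl; sym; trans; cong; cong₂; subst; module ≡-Reasoning)
open import Relation.Nullary using (¬_; Dec; yes; no; does; ¬?)
open import Relation.Nullary.Decidable using (toWitness)
open import Relation.Unary using (_≐_)

open Equivalence using (to; from)

-- A free entry whose edge ends at a leaf of the pattern asks only for a nonempty subtree, whatever
-- its value. The one free edge of another kind is that from 2 to 4 in case (iv), where a distant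
-- image is replaced by one on the right spine. So each pattern, for all values of its free entries,
-- is matched with one and the same local condition, which yields the bijection and the independence
-- of the free entries together. Counting works with types instead of coefficients: the recurrence
-- becomes a family of types, the equation for `C` a grammar, and each case has to supply only one
-- level of decomposition of its shapes. The trees on n vertices belong to the term a(n+2); the
-- terms a(1) = 2 and a(2) = 1 count no trees but are the coefficients in 2 x C and x² C.

private
  variable
    n : ℕ

-- Shapes of nonempty binary trees and their words

data Shape : Set where
  •   : Shape
  L R : Shape → Shape
  LR  : Shape → Shape → Shape

word : Shape → List Step
word •        = []
word (L s)    = FL ∷ word s
word (R s)    = FR ∷ word s
word (LR l r) = U ∷ word r ++ D ∷ word l

∥_∥ : Shape → ℕ
∥ • ∥      = 0
∥ L s ∥    = suc ∥ s ∥
∥ R s ∥    = suc ∥ s ∥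
∥ LR l r ∥ = 2 + (∥ l ∥ + ∥ r ∥)

length-word : ∀ s → length (word s) ≡ ∥ s ∥
length-word •        = refl
length-word (L s)    = cong suc (length-word s)
length-word (R s)    = cong suc (length-word s)
length-word (LR l r) rewrite length-++ (word r) {D ∷ word l} | length-word l | length-word r =
  cong suc (trans (+-suc ∥ r ∥ ∥ l ∥) (cong suc (+-comm ∥ r ∥ ∥ l ∥)))

word-motzkin : ∀ s {h q} → MotzkinFrom h q → MotzkinFrom h (word s ++ q)
word-motzkin •        m = m
word-motzkin (L s)    m = flatL (word-motzkin s m)
word-motzkin (R s)    m = flatR (word-motzkin s m)
word-motzkin (LR l r) {q = q} m rewrite ++-assoc (word r) (D ∷ word l) q =
  up (word-motzkin r (down (word-motzkin l m)))

-- Decoding reads the path from right to left and keeps a stack of shapes, one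
-- for each height still open.

push : Step → List Shape → List Shape
push U  (r ∷ l ∷ ss) = LR l r ∷ ss
push D  ss           = • ∷ ss
push FL (s ∷ ss)     = L s ∷ ss
push FR (s ∷ ss)     = R s ∷ ss
-- A default for stack underflow, which the word of a shape never causes.
push _  ss           = ss

decode : List Step → List Shape
decode = foldr push (• ∷ [])

-- Read backwards, `word s` finds a bare vertex on top of the stack and grows it into `s`; at `LR`
-- the letter `D` puts a fresh vertex on top for the right subtree, and `U` merges the two.
decode-word : ∀ s {q ss} → decode q ≡ • ∷ ss → decode (word s ++ q) ≡ s ∷ ss
decode-word •        e = e
decode-word (L s)    e = cong (push FL) (decode-word s e)
decode-word (R s)    e = cong (push FR) (decode-word s e)
decode-word (LR l r) {q} e rewrite ++-assoc (word r) (D ∷ word l) q =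
  cong (push U) (decode-word r (cong (push D) (decode-word l e)))

word-injective : ∀ {s t} → word s ≡ word t → s ≡ t
word-injective {s} {t} e = ∷-injectiveˡ (begin
  s ∷ []               ≡⟨ decode-word s refl ⟨
  decode (word s ++ []) ≡⟨ cong (λ p → decode (p ++ [])) e ⟩
  decode (word t ++ []) ≡⟨ decode-word t refl ⟩
  t ∷ []               ∎)
  where open ≡-Reasoning

unwords : ∀ {h} → Vec Shape h → List Step
unwords []       = []
unwords (s ∷ ss) = D ∷ word s ++ unwords ss

-- Cut a path at its first descents below the heights `h`, ..., 1: the pieces are words of shapes,
-- and `unwords` holds all but the first. A leading `U` merges the first two pieces, which is why
-- `h` has to vary.
motzkin-unwords : ∀ {h p} → MotzkinFrom h p → ∃₂ λ s (ss : Vec Shape h) → word s ++ unwords ss ≡ p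
motzkin-unwords end = • , [] , refl
motzkin-unwords (up m) with r , l ∷ ss , refl ← motzkin-unwords m =
  LR l r , ss , cong (U ∷_) (++-assoc (word r) (D ∷ word l) (unwords ss))
motzkin-unwords (down m) with s , ss , refl ← motzkin-unwords m = • , s ∷ ss , refl
motzkin-unwords (flatL m) with s , ss , refl ← motzkin-unwords m = L s , ss , refl
motzkin-unwords (flatR m) with s , ss , refl ← motzkin-unwords m = R s , ss , refl

motzkin-word : ∀ {p} → MotzkinFrom 0 p → ∃[ s ] word s ≡ p
motzkin-word m with s , [] , refl ← motzkin-unwords m = s , sym (++-identityʳ (word s))

-- Shapes of labelled trees

join : Maybe Shape → Maybe Shape → Shape
join nothing  nothing  = •
join (just l) nothing  = L l
join nothing  (just r) = R r
join (just l) (just r) = LR l r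

split : Shape → Maybe Shape × Maybe Shape
split •        = nothing , nothing
split (L l)    = just l , nothing
split (R r)    = nothing , just r
split (LR l r) = just l , just r

split-join : ∀ a b → split (join a b) ≡ (a , b)
split-join nothing  nothing  = refl
split-join (just l) nothing  = refl
split-join nothing  (just r) = refl
split-join (just l) (just r) = refl

shape? : BinTree n → Maybe Shape
shape? nil          = nothing
shape? (node l _ r) = just (join (shape? l) (shape? r))

f≡word : (T : BinTree n) → ∀ {s} → shape? T ≡ just s → f T ≡ word s
f≡word (node nil            _ nil)            refl = refl
f≡word (node l@(node _ _ _) _ nil)            refl = cong (FL ∷_) (f≡word l refl)
f≡word (node nil            _ r@(node _ _ _)) refl = cong (FR ∷_) (f≡word r refl)
f≡word (node l@(node _ _ _) _ r@(node _ _ _)) refl =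
  cong₂ (λ p q → U ∷ p ++ D ∷ q) (f≡word r refl) (f≡word l refl)

#nodes-shape : (T : BinTree n) → ∀ {s} → shape? T ≡ just s → #nodes T ≡ suc ∥ s ∥
#nodes-shape (node nil            _ nil)            refl = refl
#nodes-shape (node l@(node _ _ _) _ nil)            refl =
  trans (+-comm _ 1) (cong suc (#nodes-shape l refl))
#nodes-shape (node nil            _ r@(node _ _ _)) refl = cong suc (#nodes-shape r refl)
#nodes-shape (node l@(node _ _ _) _ r@(node _ _ _)) refl =
  trans (cong₂ (λ i j → i + suc j) (#nodes-shape l refl) (#nodes-shape r refl))
        (cong suc (trans (+-suc _ _) (cong suc (+-suc _ _))))

nonempty-shape : (T : BinTree n) → ∀ {k} → #nodes T ≡ suc k → ∃[ s ] shape? T ≡ just s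
nonempty-shape (node l _ r) _ = _ , refl

-- Labelled lo hi T: the labels of T in symmetric order are lo, lo + 1, …, hi − 1.

data Labelled {n} : ℕ → ℕ → BinTree n → Set where
  leaf : ∀ {lo} → Labelled lo lo nil
  node : ∀ {lo m hi l x r} → toℕ x ≡ m →
         Labelled lo m l → Labelled (suc m) hi r → Labelled lo hi (node l x r)

labelled-#nodes : ∀ {lo hi} {T : BinTree n} → Labelled lo hi T → lo + #nodes T ≡ hi
labelled-#nodes leaf = +-identityʳ _
labelled-#nodes {lo = lo} (node {m = m} {hi} {l} {r = r} _ p q) = begin
  lo + (#nodes l + suc (#nodes r)) ≡⟨ +-assoc lo _ _ ⟨
  lo + #nodes l + suc (#nodes r)   ≡⟨ cong (_+ suc (#nodes r)) (labelled-#nodes p) ⟩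
  m + suc (#nodes r)               ≡⟨ +-suc m _ ⟩
  suc m + #nodes r                 ≡⟨ labelled-#nodes q ⟩
  hi                               ∎
  where open ≡-Reasoning

labelled-≤ : ∀ {lo hi} {T : BinTree n} → Labelled lo hi T → lo ≤ hi
labelled-≤ p = subst (_ ≤_) (labelled-#nodes p) (m≤m+n _ _)

labelled-bounds : ∀ {lo hi} {T : BinTree n} → Labelled lo hi T →
                  AllVertices (λ x → lo ≤ toℕ x × toℕ x < hi) T
labelled-bounds leaf = leaf tt
labelled-bounds (node refl p q) = node
  (Tree.mapₙ (λ (lo≤ , <m) → lo≤ , <-trans <m (labelled-≤ q)) (labelled-bounds p))
  (labelled-≤ p , labelled-≤ q)
  (Tree.mapₙ (λ (m< , <hi) → ≤-trans (≤-trans (labelled-≤ p) (ℕ.n≤1+n _)) m< , <hi) (labelled-bounds q))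

labelled-search : ∀ {lo hi} {T : BinTree n} → Labelled lo hi T → SearchTree T
labelled-search leaf = leaf
labelled-search (node refl p q) =
  node (Tree.mapₙ proj₂ (labelled-bounds p)) (Tree.mapₙ proj₁ (labelled-bounds q))
       (labelled-search p) (labelled-search q)

-- Strictly separated labels cannot outnumber the interval that holds them. The bound serves to pin
-- down the root label in `search-labelled`.
search-#nodes : ∀ {lo hi} {T : BinTree n} → SearchTree T → lo ≤ hi →
                AllVertices (λ x → lo ≤ toℕ x) T → AllVertices (λ x → toℕ x < hi) T →
                lo + #nodes T ≤ hi
search-#nodes leaf lo≤hi _ _ = subst (_≤ _) (sym (+-identityʳ _)) lo≤hi
search-#nodes {lo = lo} {hi} (node {l} {x} {r} l<x x<r sl sr) lo≤hi (node lo≤l lo≤x _) (node _ x<hi r<hi) = begin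
  lo + (#nodes l + suc (#nodes r)) ≡⟨ +-assoc lo _ _ ⟨
  lo + #nodes l + suc (#nodes r)   ≤⟨ ℕ.+-monoˡ-≤ _ (search-#nodes sl lo≤x lo≤l l<x) ⟩
  toℕ x + suc (#nodes r)           ≡⟨ +-suc (toℕ x) _ ⟩
  suc (toℕ x) + #nodes r           ≤⟨ search-#nodes sr x<hi x<r r<hi ⟩
  hi                               ∎
  where open ℕ.≤-Reasoning

-- Pigeonhole: since the interval is full, the bounds from the left and the right subtree leave
-- exactly one value for the root label, and both subtrees fill their intervals in turn.
search-labelled : ∀ {lo hi} {T : BinTree n} → SearchTree T →
                  AllVertices (λ x → lo ≤ toℕ x) T → AllVertices (λ x → toℕ x < hi) T →
                  lo + #nodes T ≡ hi → Labelled lo hi T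
search-labelled leaf _ _ e = subst (λ hi → Labelled _ hi nil) (trans (sym (+-identityʳ _)) e) leaf
search-labelled {lo = lo} {hi} (node {l} {x} {r} l<x x<r sl sr) (node lo≤l lo≤x _) (node _ x<hi r<hi) e =
  node refl (search-labelled sl lo≤l l<x x≡)
            (search-labelled sr x<r r<hi (trans (cong (λ y → suc (y + #nodes r)) (sym x≡)) hi≡))
  where
  hi≡ : suc (lo + #nodes l + #nodes r) ≡ hi
  hi≡ = trans (sym (trans (sym (+-assoc lo _ _)) (+-suc (lo + #nodes l) _))) e
  x≡ : lo + #nodes l ≡ toℕ x
  x≡ = ≤-antisym (search-#nodes sl lo≤x lo≤l l<x)
         (ℕ.+-cancelʳ-≤ (#nodes r) _ _ (ℕ.≤-pred (≤-trans (search-#nodes sr x<hi x<r r<hi) (≤-reflexive (sym hi≡)))))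

allVertices : ∀ {Q : Fin n → Set} → (∀ x → Q x) → (T : BinTree n) → AllVertices Q T
allVertices q nil          = leaf tt
allVertices q (node l x r) = node (allVertices q l) (q x) (allVertices q r)

𝒯-labelled : (T : 𝒯 n) → Labelled 0 n (tree T)
𝒯-labelled T = search-labelled (search T) (allVertices (λ _ → z≤n) _) (allVertices toℕ<n _) (size T)

-- The upper ends `hi` and `hi′` may differ, because at a node the left subtrees must be compared
-- before their ends, the root labels, are known to agree; equal left subtrees then force this.
labelled-unique : ∀ {lo hi hi′} {T T′ : BinTree n} → Labelled lo hi T → Labelled lo hi′ T′ →
                  shape? T ≡ shape? T′ → T ≡ T′
labelled-unique leaf leaf _ = refl
labelled-unique (node {l = l} {x} {r} x≡ p q) (node {l = l′} {x′} {r′} x′≡ p′ q′) e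
  with e′ ← trans (sym (split-join (shape? l) (shape? r)))
              (trans (cong split (just-injective e)) (split-join (shape? l′) (shape? r′)))
  with refl ← labelled-unique p p′ (cong proj₁ e′)
  with refl ← trans (sym (labelled-#nodes p)) (labelled-#nodes p′)
  with refl ← toℕ-injective (trans x≡ (sym x′≡))
  with refl ← labelled-unique q q′ (cong proj₂ e′) = refl

Labelling : ℕ → ℕ → ℕ → Maybe Shape → Set
Labelling n lo hi t = Σ[ T ∈ BinTree n ] shape? T ≡ t × Labelled lo hi T

label-empty : ∀ {lo hi} → lo ≡ hi → Labelling n lo hi nothing
label-empty refl = nil , refl , leaf

label-node : ∀ {lo m hi a b} → m < n → Labelling n lo m a → Labelling n (suc m) hi b →
             Labelling n lo hi (just (join a b))
label-node m<n (l , refl , p) (r , refl , q) =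
  node l (fromℕ< m<n) r , refl , node (toℕ-fromℕ< m<n) p q

label : ∀ s {lo hi} → lo + suc ∥ s ∥ ≡ hi → hi ≤ n → Labelling n lo hi (just s)
label {n} • {lo} refl hi≤n =
  label-node (subst (_≤ n) (+-comm lo 1) hi≤n) (label-empty refl) (label-empty (+-comm 1 lo))
label {n} (L s) {lo} refl hi≤n =
  label-node m<n (label s refl (≤-trans (ℕ.n≤1+n _) m<n)) (label-empty (sym (+-suc lo _)))
  where m<n = subst (_≤ n) (+-suc lo _) hi≤n
label (R s) {lo} refl hi≤n =
  label-node (≤-trans (≤-trans (m≤m+n (suc lo) (suc ∥ s ∥)) (≤-reflexive (sym (+-suc lo _)))) hi≤n)
    (label-empty refl) (label s (sym (+-suc lo _)) hi≤n)
label (LR l r) {lo} refl hi≤n =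
  label-node m<n (label l refl (≤-trans (ℕ.n≤1+n _) m<n)) (label r eq hi≤n)
  where
  eq : suc (lo + suc ∥ l ∥) + suc ∥ r ∥ ≡ lo + (3 + (∥ l ∥ + ∥ r ∥))
  eq = lemma lo ∥ l ∥ ∥ r ∥
    where
    lemma : ∀ i j k → suc (i + suc j) + suc k ≡ i + (3 + (j + k))
    lemma = solve-∀
  m<n = ≤-trans (≤-trans (m≤m+n _ (suc ∥ r ∥)) (≤-reflexive eq)) hi≤n

-- Avoidance of consecutive words

_≟_ : DecidableEquality Step
U  ≟ U  = yes refl
U  ≟ D  = no λ ()
U  ≟ FL = no λ ()
U  ≟ FR = no λ ()
D  ≟ U  = no λ ()
D  ≟ D  = yes refl
D  ≟ FL = no λ ()
D  ≟ FR = no λ ()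
FL ≟ U  = no λ ()
FL ≟ D  = no λ ()
FL ≟ FL = yes refl
FL ≟ FR = no λ ()
FR ≟ U  = no λ ()
FR ≟ D  = no λ ()
FR ≟ FL = no λ ()
FR ≟ FR = yes refl

AvoidsWords : List (List Step) → List Step → Set
AvoidsWords Z p = All (λ z → ¬ Infix _≡_ z p) Z

NoPrefix : List (List Step) → List Step → Set
NoPrefix Z p = All (λ z → ¬ Prefix _≡_ z p) Z

noPrefix? : ∀ Z p → Dec (NoPrefix Z p)
noPrefix? Z p = all? (λ z → ¬? (prefix? _≟_ z p)) Z

avoids-∷ : ∀ {Z x p} → AvoidsWords Z (x ∷ p) ⇔ (NoPrefix Z (x ∷ p) × AvoidsWords Z p)
avoids-∷ = mk⇔
  (λ av → All.map (_∘ here) av , All.map (_∘ there) av)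
  (λ (np , av) → All.zipWith (λ (h , t) → λ { (here i) → h i ; (there i) → t i }) (np , av))

avoids-[] : ∀ {Z} → NoPrefix Z [] → AvoidsWords Z []
avoids-[] = All.map λ np → λ { (here i) → np i }

-- Turns an equation between Booleans, which for a concrete `Z` is checked by evaluation, into an
-- equivalence of propositions.
does-⇔ : ∀ {A : Set} (d : Dec A) {b} → does d ≡ b → T b ⇔ A
does-⇔ (yes a) refl = mk⇔ (λ _ → a) (λ _ → tt)
does-⇔ (no ¬a) refl = mk⇔ (λ ()) ¬a

-- All that can follow the word of a subtree: the end of the path or a `D`. In the four sets `D`
-- stands only in first position, so a forbidden word that starts at the letter of an edge cannot
-- run past the word of the subtree below it.
data Tail : List Step → Set where
  []  : Tail []
  D∷_ : ∀ q → Tail (D ∷ q)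

-- In the word of a tree, FL, FR, U and D each belong to the edge from a vertex
-- to a child (U to the right one and D to the left one of two children), and
-- are followed by the word of the subtree at that child.  Whether a word of Z
-- starts at that letter is read off the letter and this subtree.

record Local (Z : List (List Step)) : Set where
  field
    ok       : Step → Shape → Bool
    nonempty : NoPrefix Z []
    ok-spec  : ∀ x s {q} → Tail q → does (noPrefix? Z (x ∷ word s ++ q)) ≡ ok x s

  Good : Shape → Set
  Good •        = ⊤
  Good (L s)    = T (ok FL s) × Good s
  Good (R s)    = T (ok FR s) × Good s
  Good (LR l r) = (T (ok U r) × T (ok D l)) × Good l × Good r

  private
    ok⇔ : ∀ x s {q} → Tail q → T (ok x s) ⇔ NoPrefix Z (x ∷ word s ++ q)
    ok⇔ x s t = does-⇔ (noPrefix? Z _) (ok-spec x s t)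

  good⇒avoids : ∀ s {q} → Tail q → Good s → AvoidsWords Z q → AvoidsWords Z (word s ++ q)
  good⇒avoids •     t _       av = av
  good⇒avoids (L s) t (o , g) av = from avoids-∷ (to (ok⇔ FL s t) o , good⇒avoids s t g av)
  good⇒avoids (R s) t (o , g) av = from avoids-∷ (to (ok⇔ FR s t) o , good⇒avoids s t g av)
  good⇒avoids (LR l r) {q} t ((oᵣ , oₗ) , gₗ , gᵣ) av rewrite ++-assoc (word r) (D ∷ word l) q =
    from avoids-∷ (to (ok⇔ U r (D∷ _)) oᵣ , good⇒avoids r (D∷ _) gᵣ
      (from avoids-∷ (to (ok⇔ D l t) oₗ , good⇒avoids l t gₗ av)))

  -- Returning the avoidance of `q` as well makes the induction pass at `LR`, where what follows
  -- `word r` still contains `word l`.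
  avoids⇒good : ∀ s {q} → Tail q → AvoidsWords Z (word s ++ q) → Good s × AvoidsWords Z q
  avoids⇒good •     t av = tt , av
  avoids⇒good (L s) t av =
    let np , av′ = to avoids-∷ av ; g , avq = avoids⇒good s t av′
    in (from (ok⇔ FL s t) np , g) , avq
  avoids⇒good (R s) t av =
    let np , av′ = to avoids-∷ av ; g , avq = avoids⇒good s t av′
    in (from (ok⇔ FR s t) np , g) , avq
  avoids⇒good (LR l r) {q} t av rewrite ++-assoc (word r) (D ∷ word l) q =
    let npᵣ , av₁ = to avoids-∷ av  ; gᵣ , av₂ = avoids⇒good r (D∷ _) av₁
        npₗ , av₃ = to avoids-∷ av₂ ; gₗ , avq = avoids⇒good l t av₃
    in ((from (ok⇔ U r (D∷ _)) npᵣ , from (ok⇔ D l t) npₗ) , gₗ , gᵣ) , avq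

  avoids⇔good : ∀ s → AvoidsWords Z (word s) ⇔ Good s
  avoids⇔good s = mk⇔
    (λ av → proj₁ (avoids⇒good s [] (subst (AvoidsWords Z) (sym (++-identityʳ _)) av)))
    (λ g → subst (AvoidsWords Z) (++-identityʳ _) (good⇒avoids s [] g (avoids-[] nonempty)))

  rootOk : Maybe Shape → Maybe Shape → Bool
  rootOk nothing  nothing  = true
  rootOk (just l) nothing  = ok FL l
  rootOk nothing  (just r) = ok FR r
  rootOk (just l) (just r) = ok U r ∧ ok D l

  Occurs : BinTree n → Set
  Occurs T = ∃[ l ] ∃[ x ] ∃[ r ] node l x r ⊑ T × rootOk (shape? l) (shape? r) ≡ false

  Good? : Maybe Shape → Set
  Good? nothing  = ⊤
  Good? (just s) = Good s

  good-join : ∀ a b → Good (join a b) ⇔ (T (rootOk a b) × Good? a × Good? b)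
  good-join nothing  nothing  = mk⇔ (λ _ → tt , tt , tt) (λ _ → tt)
  good-join (just l) nothing  = mk⇔ (λ (o , g) → o , g , tt) (λ (o , g , _) → o , g)
  good-join nothing  (just r) = mk⇔ (λ (o , g) → o , tt , g) (λ (o , _ , g) → o , g)
  good-join (just l) (just r) = mk⇔ (λ (o , g) → from T-∧ o , g) (λ (o , g) → to T-∧ o , g)

  ¬occurs⇒good : (T : BinTree n) → ¬ Occurs T → Good? (shape? T)
  ¬occurs⇒good nil          ¬occ = tt
  ¬occurs⇒good (node l x r) ¬occ = from (good-join (shape? l) (shape? r))
    ( root-ok
    , ¬occurs⇒good l (λ (_ , _ , _ , ⊑l , b) → ¬occ (_ , _ , _ , left ⊑l , b))
    , ¬occurs⇒good r (λ (_ , _ , _ , ⊑r , b) → ¬occ (_ , _ , _ , right ⊑r , b)) )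
    where
    root-ok : T (rootOk (shape? l) (shape? r))
    -- The condition is a Boolean, so the negated existence in `¬occ` yields it constructively.
    root-ok with rootOk (shape? l) (shape? r) in eq
    ... | true  = tt
    ... | false = ¬occ (_ , _ , _ , here , eq)

  good⇒¬occurs : (T : BinTree n) → Good? (shape? T) → ¬ Occurs T
  good⇒¬occurs (node l x r) g (_ , _ , _ , here , b) =
    subst T b (proj₁ (to (good-join (shape? l) (shape? r)) g))
  good⇒¬occurs (node l x r) g (_ , _ , _ , left ⊑l , b) =
    good⇒¬occurs l (proj₁ (proj₂ (to (good-join (shape? l) (shape? r)) g))) (_ , _ , _ , ⊑l , b)
  good⇒¬occurs (node l x r) g (_ , _ , _ , right ⊑r , b) =
    good⇒¬occurs r (proj₂ (proj₂ (to (good-join (shape? l) (shape? r)) g))) (_ , _ , _ , ⊑r , b)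

  f-bijection : ∀ {k m} (pat : Pattern k) →
                (∀ (T : 𝒯 (suc m)) → Contains T pat ⇔ Occurs (tree T)) → f-Bijection (suc m) pat Z
  f-bijection {m = m} pat contains⇔occurs = record
    { to = to′
    ; cong = λ { refl → refl }
    ; bijective = (λ {x} {y} → injective x y) , surjective
    } , λ _ → refl
    where
    to′ : Σ (𝒯 (suc m)) (Avoids (suc m) pat) → ℳ′ m Z
    to′ (T , av) with s , eq ← nonempty-shape (tree T) (size T) = record
      { path    = f (tree T)
      ; steps   = suc-injective (begin
          suc (length (f (tree T))) ≡⟨ cong (suc ∘ length) f≡ ⟩
          suc (length (word s))     ≡⟨ cong suc (length-word s) ⟩
          suc ∥ s ∥                 ≡⟨ #nodes-shape (tree T) eq ⟨
          #nodes (tree T)           ≡⟨ size T ⟩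
          suc m                     ∎)
      ; motzkin = subst (MotzkinFrom 0) (trans (++-identityʳ _) (sym f≡)) (word-motzkin s end)
      ; avoids  = subst (AvoidsWords Z) (sym f≡) (from (avoids⇔good s)
          (subst Good? eq (¬occurs⇒good (tree T) (av ∘ from (contains⇔occurs T)))))
      }
      where
      open ≡-Reasoning
      f≡ : f (tree T) ≡ word s
      f≡ = f≡word (tree T) eq

    injective : ∀ (x y : Σ (𝒯 (suc m)) (Avoids (suc m) pat)) →
                f (tree (proj₁ x)) ≡ f (tree (proj₁ y)) → tree (proj₁ x) ≡ tree (proj₁ y)
    injective (T , _) (T′ , _) e
      with s , eq ← nonempty-shape (tree T) (size T) | s′ , eq′ ← nonempty-shape (tree T′) (size T′) =
      labelled-unique (𝒯-labelled T) (𝒯-labelled T′) (trans eq (trans (cong just s≡s′) (sym eq′)))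
      where
      s≡s′ : s ≡ s′
      s≡s′ = word-injective (trans (sym (f≡word (tree T) eq)) (trans e (f≡word (tree T′) eq′)))

    surjective : ∀ (p : ℳ′ m Z) → Σ[ x ∈ Σ (𝒯 (suc m)) (Avoids (suc m) pat) ]
                 (∀ {y : Σ (𝒯 (suc m)) (Avoids (suc m) pat)} →
                    tree (proj₁ y) ≡ tree (proj₁ x) → f (tree (proj₁ y)) ≡ path p)
    surjective p with motzkin-word (ℳ′.motzkin p)
    ... | s , w≡ with label s (cong suc (trans (sym (length-word s)) (trans (cong length w≡) (ℳ′.steps p)))) ≤-refl
    ... | T , eq , lab =
      (S , λ c → good⇒¬occurs T good (to (contains⇔occurs S) c)) , λ { refl → trans (f≡word T eq) w≡ }
      where
      S : 𝒯 (suc m)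
      S = mk𝒯 T (labelled-#nodes lab) (labelled-search lab)

      good : Good? (shape? T)
      good = subst Good? (sym eq) (to (avoids⇔good s) (subst (AvoidsWords Z) (sym w≡) (ℳ′.avoids p)))

-- Occurrences of tree patterns

⊑-trans : {S S′ T : BinTree n} → S ⊑ S′ → S′ ⊑ T → S ⊑ T
⊑-trans p here      = p
⊑-trans p (left q)  = left (⊑-trans p q)
⊑-trans p (right q) = right (⊑-trans p q)

⊑-search : {S T : BinTree n} → S ⊑ T → SearchTree T → SearchTree S
⊑-search here      s                = s
⊑-search (left p)  (node _ _ sl _)  = ⊑-search p sl
⊑-search (right p) (node _ _ _ sr)  = ⊑-search p sr

⊑-all : ∀ {Q : Fin n → Set} {l x r T} → AllVertices Q T → node l x r ⊑ T → Q x
⊑-all (node _ q _) here      = q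
⊑-all (node a _ _) (left p)  = ⊑-all a p
⊑-all (node _ _ a) (right p) = ⊑-all a p

-- A label cannot lie on both sides of a vertex, nor both at a vertex and below it. This glues the
-- edges of an occurrence, each found in `T` separately, at their common vertices.
⊑-unique : ∀ {l x r l′ r′} {T : BinTree n} → SearchTree T →
           node l x r ⊑ T → node l′ x r′ ⊑ T → l ≡ l′ × r ≡ r′
⊑-unique (node l< <r _  _)  here      here      = refl , refl
⊑-unique (node l< <r _  _)  here      (left q)  = ⊥-elim (<-irrefl refl (⊑-all l< q))
⊑-unique (node l< <r _  _)  here      (right q) = ⊥-elim (<-irrefl refl (⊑-all <r q))
⊑-unique (node l< <r _  _)  (left p)  here      = ⊥-elim (<-irrefl refl (⊑-all l< p))
⊑-unique (node l< <r sl _)  (left p)  (left q)  = ⊑-unique sl p q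
⊑-unique (node l< <r _  _)  (left p)  (right q) = ⊥-elim (<-irrefl refl (<-trans (⊑-all l< p) (⊑-all <r q)))
⊑-unique (node l< <r _  _)  (right p) here      = ⊥-elim (<-irrefl refl (⊑-all <r p))
⊑-unique (node l< <r _  _)  (right p) (left q)  = ⊥-elim (<-irrefl refl (<-trans (⊑-all l< q) (⊑-all <r p)))
⊑-unique (node l< <r _  sr) (right p) (right q) = ⊑-unique sr p q

data NonEmpty {n} : BinTree n → Set where
  node : ∀ {l x r} → NonEmpty (node l x r)

⊑-nonEmpty : ∀ {l x r} {T : BinTree n} → node l x r ⊑ T → NonEmpty T
⊑-nonEmpty here      = node
⊑-nonEmpty (left _)  = node
⊑-nonEmpty (right _) = node

child⇒inSubtree : ∀ {T : BinTree n} {s i j} → Child T s i j → InSubtree T s i j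
child⇒inSubtree (S , sub , r) = S , sub , S , here , r

edge⇒inSubtree : ∀ b {T : BinTree n} {s i j} → Edge b T s i j → InSubtree T s i j
edge⇒inSubtree true  = child⇒inSubtree
edge⇒inSubtree false = id

child⇒edge : ∀ b {T : BinTree n} {s i j} → Child T s i j → Edge b T s i j
child⇒edge true  = id
child⇒edge false = child⇒inSubtree

-- The nonempty subtree is all that is kept of an edge to a leaf of a pattern, and it results from
-- either entry.
edge⇒left : ∀ b {T : BinTree n} {i j} → Edge b T left i j → ∃₂ λ l r → node l i r ⊑ T × NonEmpty l
edge⇒left b e with edge⇒inSubtree b e
... | _ , left p , _ , q , root = _ , _ , p , ⊑-nonEmpty q

edge⇒right : ∀ b {T : BinTree n} {i j} → Edge b T right i j → ∃₂ λ l r → node l i r ⊑ T × NonEmpty r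
edge⇒right b e with edge⇒inSubtree b e
... | _ , right p , _ , q , root = _ , _ , p , ⊑-nonEmpty q

-- A contiguous copy of a pattern at the top of `S`; where the pattern has no child, that side of
-- `S` is unrestricted.
data Aligned {k n} (φ : Fin k → Fin n) : BinTree k → BinTree n → Set where
  leaf : ∀ {S} → Aligned φ nil S
  node : ∀ {l i r l′ x r′} → x ≡ φ i → Aligned φ l l′ → Aligned φ r r′ →
         Aligned φ (node l i r) (node l′ x r′)

aligned-⊑ : ∀ {k} {φ : Fin k → Fin n} {l i r P S} → Aligned φ P S → node l i r ⊑ P →
            ∃₂ λ l′ r′ → node l′ (φ i) r′ ⊑ S × Aligned φ l l′ × Aligned φ r r′
aligned-⊑ (node refl al ar) here = _ , _ , here , al , ar
aligned-⊑ (node _ al ar) (left p)  =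
  let l′ , r′ , q , al′ , ar′ = aligned-⊑ al p in l′ , r′ , left q , al′ , ar′
aligned-⊑ (node _ al ar) (right p) =
  let l′ , r′ , q , al′ , ar′ = aligned-⊑ ar p in l′ , r′ , right q , al′ , ar′

aligned-root : ∀ {k} {φ : Fin k → Fin n} {i P S} → Aligned φ P S → IsRoot i P → IsRoot (φ i) S
aligned-root (node refl _ _) root = root

aligned-child : ∀ {k} {φ : Fin k → Fin n} {P S s p i} → Aligned φ P S →
                Child P s p i → Child S s (φ p) (φ i)
aligned-child a (_ , left p , ρ) =
  let _ , _ , q , al , _ = aligned-⊑ a p in _ , left q , aligned-root al ρ
aligned-child a (_ , right p , ρ) =
  let _ , _ , q , _ , ar = aligned-⊑ a p in _ , right q , aligned-root ar ρ

⊑-child : ∀ {S T : BinTree n} {s i j} → S ⊑ T → Child S s i j → Child T s i j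
⊑-child p (_ , left q , ρ)  = _ , left (⊑-trans q p) , ρ
⊑-child p (_ , right q , ρ) = _ , right (⊑-trans q p) , ρ

-- In a contiguous copy every edge is a parent-child edge, which satisfies both kinds of entry, so
-- one copy serves all values of `e`.
aligned⇒contains : ∀ {k} {φ : Fin k → Fin n} {S} (T : 𝒯 n) (pat : Pattern k) → Injective _≡_ _≡_ φ →
                   S ⊑ tree T → Aligned φ (tree (Pattern.P pat)) S → Contains T pat
aligned⇒contains {φ = φ} T pat inj p a =
  φ , inj , λ i nonroot s j c → child⇒edge (Pattern.e pat i nonroot) (⊑-child p (aligned-child a c))

four : (a b c d : Fin n) → Fin 4 → Fin n
four a b c d v₁ = a
four a b c d v₂ = b
four a b c d v₃ = c
four a b c d v₄ = d

module _ {a b c d : Fin n} (a<b : a Fin.< b) (b<c : b Fin.< c) (c<d : c Fin.< d) where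

  four-mono : ∀ {i j} → i Fin.< j → four a b c d i Fin.< four a b c d j
  four-mono {v₁} {v₂} _ = a<b
  four-mono {v₁} {v₃} _ = <-trans a<b b<c
  four-mono {v₁} {v₄} _ = <-trans a<b (<-trans b<c c<d)
  four-mono {v₂} {v₃} _ = b<c
  four-mono {v₂} {v₄} _ = <-trans b<c c<d
  four-mono {v₃} {v₄} _ = c<d
  four-mono {v₂} {v₂} (s≤s ())
  four-mono {v₃} {v₂} (s≤s ())
  four-mono {v₃} {v₃} (s≤s (s≤s ()))
  four-mono {v₄} {v₂} (s≤s ())
  four-mono {v₄} {v₃} (s≤s (s≤s ()))
  four-mono {v₄} {v₄} (s≤s (s≤s (s≤s ())))

  -- The search property of a copy orders its four labels as in the pattern, and this order makes
  -- them distinct.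
  four-injective : Injective _≡_ _≡_ (four a b c d)
  four-injective {i} {j} e with <-cmp i j
  ... | tri< i<j _ _ = ⊥-elim (<-irrefl (cong toℕ e) (four-mono i<j))
  ... | tri≈ _ i≡j _ = i≡j
  ... | tri> _ _ j<i = ⊥-elim (<-irrefl (cong toℕ (sym e)) (four-mono j<i))

-- The four local conditions

-- A word begins with `FL` or `U` exactly if the root has a left child, with `FR` or `U` exactly if
-- it has a right child, and with `U` exactly if it has both. After `FR` or `U` comes the word of
-- the right subtree. This is the origin of the alternatives in the sets `Z`.
hasLeft hasRight rightHasLeft : Shape → Bool
hasLeft •        = false
hasLeft (L _)    = true
hasLeft (R _)    = false
hasLeft (LR _ _) = true

hasRight •        = false
hasRight (L _)    = false
hasRight (R _)    = true
hasRight (LR _ _) = true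

rightHasLeft •        = false
rightHasLeft (L _)    = false
rightHasLeft (R s)    = hasLeft s
rightHasLeft (LR _ s) = hasLeft s

local₁ : Local Z₁
local₁ = record { ok = ok ; nonempty = toWitness {a? = noPrefix? Z₁ []} tt ; ok-spec = spec }
  where
  ok : Step → Shape → Bool
  ok U s = not (hasRight s)
  ok _ _ = true

  spec : ∀ x s {q} → Tail q → does (noPrefix? Z₁ (x ∷ word s ++ q)) ≡ ok x s
  spec D  _        _      = refl
  spec FL _        _      = refl
  spec FR _        _      = refl
  -- Below a bare vertex the next letter comes from the tail, so both tails have to be evaluated.
  spec U  •        []     = refl
  spec U  •        (D∷ _) = refl
  spec U  (L _)    _      = refl
  spec U  (R _)    _      = refl
  spec U  (LR _ _) _      = refl

local₂ : Local Z₂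
local₂ = record { ok = ok ; nonempty = toWitness {a? = noPrefix? Z₂ []} tt ; ok-spec = spec }
  where
  ok : Step → Shape → Bool
  ok D s = not (hasLeft s)
  ok _ _ = true

  spec : ∀ x s {q} → Tail q → does (noPrefix? Z₂ (x ∷ word s ++ q)) ≡ ok x s
  spec U  _        _      = refl
  spec FL _        _      = refl
  spec FR _        _      = refl
  spec D  •        []     = refl
  spec D  •        (D∷ _) = refl
  spec D  (L _)    _      = refl
  spec D  (R _)    _      = refl
  spec D  (LR _ _) _      = refl

local₃ : Local Z₃
local₃ = record { ok = ok ; nonempty = toWitness {a? = noPrefix? Z₃ []} tt ; ok-spec = spec }
  where
  both : Shape → Bool
  both s = hasLeft s ∧ hasRight s

  ok : Step → Shape → Bool
  ok U  s = not (both s)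
  ok FR s = not (both s)
  ok _  _ = true

  spec : ∀ x s {q} → Tail q → does (noPrefix? Z₃ (x ∷ word s ++ q)) ≡ ok x s
  spec D  _        _      = refl
  spec FL _        _      = refl
  spec U  •        []     = refl
  spec U  •        (D∷ _) = refl
  spec U  (L _)    _      = refl
  spec U  (R _)    _      = refl
  spec U  (LR _ _) _      = refl
  spec FR •        []     = refl
  spec FR •        (D∷ _) = refl
  spec FR (L _)    _      = refl
  spec FR (R _)    _      = refl
  spec FR (LR _ _) _      = refl

local₄ : Local Z₄
local₄ = record { ok = ok ; nonempty = toWitness {a? = noPrefix? Z₄ []} tt ; ok-spec = spec }
  where
  ok : Step → Shape → Bool
  ok U  s = not (rightHasLeft s)
  ok FR s = not (rightHasLeft s)
  ok _  _ = true

  spec : ∀ x s {q} → Tail q → does (noPrefix? Z₄ (x ∷ word s ++ q)) ≡ ok x s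
  spec D  _               _      = refl
  spec FL _               _      = refl
  spec U  •               []     = refl
  spec U  •               (D∷ _) = refl
  spec U  (L _)           _      = refl
  spec U  (R •)           []     = refl
  spec U  (R •)           (D∷ _) = refl
  spec U  (R (L _))       _      = refl
  spec U  (R (R _))       _      = refl
  spec U  (R (LR _ _))    _      = refl
  spec U  (LR _ •)        _      = refl
  spec U  (LR _ (L _))    _      = refl
  spec U  (LR _ (R _))    _      = refl
  spec U  (LR _ (LR _ _)) _      = refl
  spec FR •               []     = refl
  spec FR •               (D∷ _) = refl
  spec FR (L _)           _      = refl
  spec FR (R •)           []     = refl
  spec FR (R •)           (D∷ _) = refl
  spec FR (R (L _))       _      = refl
  spec FR (R (R _))       _      = refl
  spec FR (R (LR _ _))    _      = refl
  spec FR (LR _ •)        _      = refl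
  spec FR (LR _ (L _))    _      = refl
  spec FR (LR _ (R _))    _      = refl
  spec FR (LR _ (LR _ _)) _      = refl

pattern₁ pattern₂ pattern₃ pattern₄ : Bool → Bool → Pattern 4
pattern₁ x y = ⟨ P2134 ∣ x ∷ true ∷ y ∷ [] ⟩
pattern₂ x y = ⟨ P3214 ∣ true ∷ x ∷ y ∷ [] ⟩
pattern₃ x y = ⟨ P1324 ∣ true ∷ x ∷ y ∷ [] ⟩
pattern₄ x y = ⟨ P1243 ∣ true ∷ x ∷ y ∷ [] ⟩

-- Containment of each pattern as a local condition

module _ {n} (T : 𝒯 n) where

  contains₁⇔occurs : ∀ x y → Contains T (pattern₁ x y) ⇔ Local.Occurs local₁ (tree T)
  contains₁⇔occurs x y = mk⇔ contains⇒occurs occurs⇒contains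
    where
    open Local local₁

    contains⇒occurs : Contains T (pattern₁ x y) → Occurs (tree T)
    contains⇒occurs (φ , _ , h)
      -- The entry of this edge evaluates to `true`, so `h` gives a child; the next two edges carry
      -- the arbitrary entries `x` and `y`.
      with _ , right p , root ← h v₃ (λ ()) right v₂ (_ , right here , root)
      with _ , _ , q , l≠∅ ← edge⇒left x (h v₁ (λ ()) left v₂ (_ , left here , root))
      with _ , _ , q′ , r≠∅ ← edge⇒right y (h v₄ (λ ()) right v₃ (_ , right (right here) , root))
      with refl , refl ← ⊑-unique (search T) q p
      with refl , refl ← ⊑-unique (search T) q′ (⊑-trans (right here) p)
      = occurrence p l≠∅ r≠∅
      where
      occurrence : ∀ {l l′ r b c} → node l b (node l′ c r) ⊑ tree T →
                   NonEmpty l → NonEmpty r → Occurs (tree T)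
      -- `hasRight` has the same value with and without `l′`, but the shape only computes after the
      -- split.
      occurrence {l′ = nil}        p node node = _ , _ , _ , p , refl
      occurrence {l′ = node _ _ _} p node node = _ , _ , _ , p , refl

    embed : ∀ {a b c d l₁ r₁ l₃ l₄ r₄} →
            node (node l₁ a r₁) b (node l₃ c (node l₄ d r₄)) ⊑ tree T → Contains T (pattern₁ x y)
    embed p with ⊑-search p (search T)
    ... | node (node _ a<b _) (node _ b<c _) _ (node _ (node _ c<d _) _ _) =
      aligned⇒contains T (pattern₁ x y) (four-injective a<b b<c c<d) p
        (node refl (node refl leaf leaf) (node refl leaf (node refl leaf leaf)))

    occurs⇒contains : Occurs (tree T) → Contains T (pattern₁ x y)
    occurs⇒contains (node _ _ _ , _ , node nil          _ (node _ _ _) , p , _) = embed p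
    occurs⇒contains (node _ _ _ , _ , node (node _ _ _) _ (node _ _ _) , p , _) = embed p
    occurs⇒contains (nil        , _ , nil                              , _ , ())
    occurs⇒contains (nil        , _ , node _ _ _                       , _ , ())
    occurs⇒contains (node _ _ _ , _ , nil                              , _ , ())
    occurs⇒contains (node _ _ _ , _ , node nil          _ nil          , _ , ())
    occurs⇒contains (node _ _ _ , _ , node (node _ _ _) _ nil          , _ , ())

  contains₂⇔occurs : ∀ x y → Contains T (pattern₂ x y) ⇔ Local.Occurs local₂ (tree T)
  contains₂⇔occurs x y = mk⇔ contains⇒occurs occurs⇒contains
    where
    open Local local₂

    contains⇒occurs : Contains T (pattern₂ x y) → Occurs (tree T)
    contains⇒occurs (φ , _ , h)
      with _ , left p , root ← h v₂ (λ ()) left v₃ (_ , left here , root)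
      with _ , _ , q , r≠∅ ← edge⇒right y (h v₄ (λ ()) right v₃ (_ , right here , root))
      with _ , _ , q′ , l≠∅ ← edge⇒left x (h v₁ (λ ()) left v₂ (_ , left (left here) , root))
      with refl , refl ← ⊑-unique (search T) q p
      with refl , refl ← ⊑-unique (search T) q′ (⊑-trans (left here) p)
      = occurrence p l≠∅ r≠∅
      where
      occurrence : ∀ {l r′ r b c} → node (node l b r′) c r ⊑ tree T →
                   NonEmpty l → NonEmpty r → Occurs (tree T)
      occurrence {r′ = nil}        p node node = _ , _ , _ , p , refl
      occurrence {r′ = node _ _ _} p node node = _ , _ , _ , p , refl

    embed : ∀ {a b c d l₁ r₁ r₂ l₄ r₄} →
            node (node (node l₁ a r₁) b r₂) c (node l₄ d r₄) ⊑ tree T → Contains T (pattern₂ x y)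
    embed p with ⊑-search p (search T)
    ... | node (node _ b<c _) (node _ c<d _) (node (node _ a<b _) _ _ _) _ =
      aligned⇒contains T (pattern₂ x y) (four-injective a<b b<c c<d) p
        (node refl (node refl (node refl leaf leaf) leaf) (node refl leaf leaf))

    occurs⇒contains : Occurs (tree T) → Contains T (pattern₂ x y)
    occurs⇒contains (node (node _ _ _) _ nil          , _ , node _ _ _ , p , _) = embed p
    occurs⇒contains (node (node _ _ _) _ (node _ _ _) , _ , node _ _ _ , p , _) = embed p
    occurs⇒contains (nil                              , _ , nil        , _ , ())
    occurs⇒contains (nil                              , _ , node _ _ _ , _ , ())
    occurs⇒contains (node _ _ _                       , _ , nil        , _ , ())
    occurs⇒contains (node nil          _ nil          , _ , node _ _ _ , _ , ())
    occurs⇒contains (node nil          _ (node _ _ _) , _ , node _ _ _ , _ , ())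

  contains₃⇔occurs : ∀ x y → Contains T (pattern₃ x y) ⇔ Local.Occurs local₃ (tree T)
  contains₃⇔occurs x y = mk⇔ contains⇒occurs occurs⇒contains
    where
    open Local local₃

    contains⇒occurs : Contains T (pattern₃ x y) → Occurs (tree T)
    contains⇒occurs (φ , _ , h)
      with _ , right p , root ← h v₃ (λ ()) right v₁ (_ , right here , root)
      with _ , _ , q , l≠∅ ← edge⇒left x (h v₂ (λ ()) left v₃ (_ , left (right here) , root))
      with _ , _ , q′ , r≠∅ ← edge⇒right y (h v₄ (λ ()) right v₃ (_ , right (right here) , root))
      with refl , refl ← ⊑-unique (search T) q (⊑-trans (right here) p)
      with refl , refl ← ⊑-unique (search T) q′ (⊑-trans (right here) p)
      = occurrence p l≠∅ r≠∅
      where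
      occurrence : ∀ {l′ l r a c} → node l′ a (node l c r) ⊑ tree T →
                   NonEmpty l → NonEmpty r → Occurs (tree T)
      occurrence {l′ = nil}        p node node = _ , _ , _ , p , refl
      occurrence {l′ = node _ _ _} p node node = _ , _ , _ , p , refl

    embed : ∀ {a b c d l₁ l₂ r₂ l₄ r₄} →
            node l₁ a (node (node l₂ b r₂) c (node l₄ d r₄)) ⊑ tree T → Contains T (pattern₃ x y)
    embed p with ⊑-search p (search T)
    ... | node _ (node (node _ a<b _) _ _) _ (node (node _ b<c _) (node _ c<d _) _ _) =
      aligned⇒contains T (pattern₃ x y) (four-injective a<b b<c c<d) p
        (node refl leaf (node refl (node refl leaf leaf) (node refl leaf leaf)))

    occurs⇒contains : Occurs (tree T) → Contains T (pattern₃ x y)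
    occurs⇒contains (_          , _ , node (node _ _ _) _ (node _ _ _) , p , _) = embed p
    occurs⇒contains (nil        , _ , nil                              , _ , ())
    occurs⇒contains (node _ _ _ , _ , nil                              , _ , ())
    occurs⇒contains (nil        , _ , node nil          _ nil          , _ , ())
    occurs⇒contains (nil        , _ , node nil          _ (node _ _ _) , _ , ())
    occurs⇒contains (nil        , _ , node (node _ _ _) _ nil          , _ , ())
    occurs⇒contains (node _ _ _ , _ , node nil          _ nil          , _ , ())
    occurs⇒contains (node _ _ _ , _ , node nil          _ (node _ _ _) , _ , ())
    occurs⇒contains (node _ _ _ , _ , node (node _ _ _) _ nil          , _ , ())

  contains₄⇔occurs : ∀ x y → Contains T (pattern₄ x y) ⇔ Local.Occurs local₄ (tree T)
  contains₄⇔occurs x y = mk⇔ contains⇒occurs occurs⇒contains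
    where
    open Local local₄

    occurrence : ∀ {l l′ l″ r″ a b c} → node l a (node l′ b (node l″ c r″)) ⊑ tree T →
                 NonEmpty l″ → Occurs (tree T)
    occurrence {nil}        {nil}        {r″ = nil}        p node = _ , _ , _ , p , refl
    occurrence {nil}        {nil}        {r″ = node _ _ _} p node = _ , _ , _ , p , refl
    occurrence {nil}        {node _ _ _} {r″ = nil}        p node = _ , _ , _ , p , refl
    occurrence {nil}        {node _ _ _} {r″ = node _ _ _} p node = _ , _ , _ , p , refl
    occurrence {node _ _ _} {nil}        {r″ = nil}        p node = _ , _ , _ , p , refl
    occurrence {node _ _ _} {nil}        {r″ = node _ _ _} p node = _ , _ , _ , p , refl
    occurrence {node _ _ _} {node _ _ _} {r″ = nil}        p node = _ , _ , _ , p , refl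
    occurrence {node _ _ _} {node _ _ _} {r″ = node _ _ _} p node = _ , _ , _ , p , refl

    -- Walking down the right spine below b, the first vertex with a left child
    -- is the third vertex of the pattern.
    spine : ∀ {a b l l′ r′ c l″ r″} → node l a (node l′ b r′) ⊑ tree T →
            node l″ c r″ ⊑ r′ → NonEmpty l″ → Occurs (tree T)
    spine p here      l≠∅ = occurrence p l≠∅
    spine p (left q)  l≠∅ = occurrence p (⊑-nonEmpty q)
    spine p (right q) l≠∅ = spine (⊑-trans (right here) p) q l≠∅

    contains⇒occurs : Contains T (pattern₄ x y) → Occurs (tree T)
    contains⇒occurs (φ , _ , h)
      with _ , right p , root ← h v₂ (λ ()) right v₁ (_ , right here , root)
      -- With entry 0 the image of 4 may lie anywhere in the right subtree of the image of 2. Only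
      -- this position `q′` is kept, and `spine` trades it for a contiguous occurrence.
      with _ , right q , _ , q′ , root ← edge⇒inSubtree x (h v₄ (λ ()) right v₂ (_ , right (right here) , root))
      with _ , _ , q″ , l≠∅ ← edge⇒left y (h v₃ (λ ()) left v₄ (_ , left (right (right here)) , root))
      with refl , refl ← ⊑-unique (search T) q (⊑-trans (right here) p)
      with refl , refl ← ⊑-unique (search T) q″ (⊑-trans q′ (⊑-trans (right here) q))
      = spine p q′ l≠∅

    embed : ∀ {a b c d l₁ l₂ l₃ r₃ r₄} →
            node l₁ a (node l₂ b (node (node l₃ c r₃) d r₄)) ⊑ tree T → Contains T (pattern₄ x y)
    embed p with ⊑-search p (search T)
    ... | node _ (node _ a<b _) _ (node _ (node (node _ b<c _) _ _) _ (node (node _ c<d _) _ _ _)) =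
      aligned⇒contains T (pattern₄ x y) (four-injective a<b b<c c<d) p
        (node refl leaf (node refl leaf (node refl (node refl leaf leaf) leaf)))

    occurs⇒contains : Occurs (tree T) → Contains T (pattern₄ x y)
    occurs⇒contains (_          , _ , node _ _ (node (node _ _ _) _ _)                 , p , _) = embed p
    occurs⇒contains (nil        , _ , nil                                              , _ , ())
    occurs⇒contains (node _ _ _ , _ , nil                                              , _ , ())
    occurs⇒contains (nil        , _ , node nil          _ nil                          , _ , ())
    occurs⇒contains (nil        , _ , node (node _ _ _) _ nil                          , _ , ())
    occurs⇒contains (nil        , _ , node nil          _ (node nil _ nil)             , _ , ())
    occurs⇒contains (nil        , _ , node (node _ _ _) _ (node nil _ nil)             , _ , ())
    occurs⇒contains (nil        , _ , node nil          _ (node nil _ (node _ _ _))    , _ , ())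
    occurs⇒contains (nil        , _ , node (node _ _ _) _ (node nil _ (node _ _ _))    , _ , ())
    occurs⇒contains (node _ _ _ , _ , node nil          _ nil                          , _ , ())
    occurs⇒contains (node _ _ _ , _ , node (node _ _ _) _ nil                          , _ , ())
    occurs⇒contains (node _ _ _ , _ , node nil          _ (node nil _ nil)             , _ , ())
    occurs⇒contains (node _ _ _ , _ , node (node _ _ _) _ (node nil _ nil)             , _ , ())
    occurs⇒contains (node _ _ _ , _ , node nil          _ (node nil _ (node _ _ _))    , _ , ())
    occurs⇒contains (node _ _ _ , _ , node (node _ _ _) _ (node nil _ (node _ _ _))    , _ , ())

-- The sequence A025242

A025242-upTo≡ : ∀ m → A025242-upTo m ≡ applyDownFrom (A025242 ∘ suc) (3 + m)
A025242-upTo≡ zero    = refl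
A025242-upTo≡ (suc m) = cong (A025242 (4 + m) ∷_) (A025242-upTo≡ m)

zipWith-applyUpTo-applyDownFrom : ∀ (g h : ℕ → ℕ) k j →
  zipWith _*_ (applyUpTo g (k + j)) (take k (applyDownFrom h (k + j))) ≡
  applyUpTo (λ i → g i * h (k ∸ suc i + j)) k
zipWith-applyUpTo-applyDownFrom g h zero    zero    = refl
zipWith-applyUpTo-applyDownFrom g h zero    (suc j) = refl
zipWith-applyUpTo-applyDownFrom g h (suc k) j       =
  cong (g 0 * h (k + j) ∷_) (zipWith-applyUpTo-applyDownFrom (g ∘ suc) h k j)

-- The recursive step of `A025242-upTo`, named so that its argument can be rewritten:
-- `A025242 (4 + m)` unfolds to `conv (A025242-upTo m)`.
conv : List ℕ → ℕ
conv as = sum (zipWith _*_ (reverse as) (take (length as ∸ 2) as))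

conv-applyDownFrom : ∀ (g : ℕ → ℕ) k → conv (applyDownFrom g (k + 2)) ≡
                     sum (applyUpTo (λ i → g i * g (k ∸ suc i + 2)) k)
conv-applyDownFrom g k = cong sum (begin
  zipWith _*_ (reverse as) (take (length as ∸ 2) as)
    ≡⟨ cong₂ (λ bs l → zipWith _*_ bs (take (l ∸ 2) as))
         (reverse-applyDownFrom g (k + 2)) (length-applyDownFrom g (k + 2)) ⟩
  zipWith _*_ (applyUpTo g (k + 2)) (take (k + 2 ∸ 2) as)
    ≡⟨ cong (λ l → zipWith _*_ (applyUpTo g (k + 2)) (take l as)) (ℕ.m+n∸n≡m k 2) ⟩
  zipWith _*_ (applyUpTo g (k + 2)) (take k as)
    ≡⟨ zipWith-applyUpTo-applyDownFrom g g k 2 ⟩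
  applyUpTo (λ i → g i * g (k ∸ suc i + 2)) k ∎)
  where
  open ≡-Reasoning
  as = applyDownFrom g (k + 2)

A025242-rec : ∀ m → A025242 (4 + m) ≡
              sum (applyUpTo (λ i → A025242 (suc i) * A025242 (suc (m ∸ i + 2))) (suc m))
A025242-rec m = trans
  (cong conv (trans (A025242-upTo≡ m) (cong (applyDownFrom (A025242 ∘ suc)) (+-comm 2 (suc m)))))
  (conv-applyDownFrom (A025242 ∘ suc) (suc m))

Fin-sum↔Σ : ∀ (g : ℕ → ℕ) k → Fin (sum (applyUpTo g k)) ↔ Σ (Fin k) (Fin ∘ g ∘ toℕ)
Fin-sum↔Σ g zero    = mk↔ₛ′ (λ ()) (λ ()) (λ ()) (λ ())
Fin-sum↔Σ g (suc k) = ↔-trans +↔⊎ (↔-trans (↔-refl ⊎-↔ Fin-sum↔Σ (g ∘ suc) k) ⊎↔Σ)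
  where
  ⊎↔Σ : (Fin (g 0) ⊎ Σ (Fin k) (Fin ∘ g ∘ suc ∘ toℕ)) ↔ Σ (Fin (suc k)) (Fin ∘ g ∘ toℕ)
  ⊎↔Σ = mk↔ₛ′
    (λ { (inj₁ x) → zero , x ; (inj₂ (i , x)) → suc i , x })
    (λ { (zero , x) → inj₁ x ; (suc i , x) → inj₂ (i , x) })
    (λ { (zero , x) → refl ; (suc i , x) → refl })
    (λ { (inj₁ x) → refl ; (inj₂ (i , x)) → refl })

-- The recurrence read as a type: `a₁` and `b₁` for a(1) = 2, `a₂` and `a₃` for the other initial
-- values, and `pair` for the products in the convolution.
data Conv : ℕ → Set where
  a₁ b₁ : Conv 1
  a₂    : Conv 2
  a₃    : Conv 3
  pair  : ∀ {m} (i : Fin (suc m)) → Conv (suc (toℕ i)) → Conv (3 + (m ∸ toℕ i)) → Conv (4 + m)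

Fin↔Conv : ∀ n → Fin (A025242 n) ↔ Conv n
Fin↔Conv = <-rec _ step
  where
  step : ∀ n → (∀ {i} → i < n → Fin (A025242 i) ↔ Conv i) → Fin (A025242 n) ↔ Conv n
  step 0 _ = mk↔ₛ′ (λ ()) (λ ()) (λ ()) (λ ())
  step 1 _ = mk↔ₛ′ (λ { zero → a₁ ; (suc zero) → b₁ }) (λ { a₁ → zero ; b₁ → suc zero })
                   (λ { a₁ → refl ; b₁ → refl }) (λ { zero → refl ; (suc zero) → refl })
  step 2 _ = mk↔ₛ′ (λ _ → a₂) (λ _ → zero) (λ { a₂ → refl }) (λ { zero → refl })
  step 3 _ = mk↔ₛ′ (λ _ → a₃) (λ _ → zero) (λ { a₃ → refl }) (λ { zero → refl })
  step (suc (suc (suc (suc m)))) rec rewrite A025242-rec m =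
    ↔-trans (Fin-sum↔Σ (λ i → A025242 (suc i) * A025242 (suc (m ∸ i + 2))) (suc m))
      (↔-trans (Σ.congˡ (λ {i} → ↔-trans *↔× (rec (i< i) ×-↔ second i))) Σ↔Conv)
    where
    i< : ∀ (i : Fin (suc m)) → suc (toℕ i) < 4 + m
    i< i = s≤s (≤-trans (toℕ<n i) (m≤n+m (suc m) 2))

    second : ∀ (i : Fin (suc m)) → Fin (A025242 (suc (m ∸ toℕ i + 2))) ↔ Conv (3 + (m ∸ toℕ i))
    second i = subst (λ j → Fin (A025242 (suc j)) ↔ Conv (3 + (m ∸ toℕ i))) (+-comm 2 (m ∸ toℕ i))
                     (rec (ℕ.+-monoʳ-≤ 4 (ℕ.m∸n≤m m (toℕ i))))

    Σ↔Conv : Σ (Fin (suc m)) (λ i → Conv (suc (toℕ i)) × Conv (3 + (m ∸ toℕ i))) ↔ Conv (4 + m)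
    Σ↔Conv = mk↔ₛ′ (λ (i , x , y) → pair i x y) (λ { (pair i x y) → i , x , y })
                   (λ { (pair i x y) → refl }) (λ { (i , x , y) → refl })

-- The generating function C = x + 2 x C + x² C + x² C² of A025242 as a grammar

data Layer (A : Set) : Set where
  one             : Layer A
  stepL stepR two : A → Layer A
  pair            : A → A → Layer A

map-layer : ∀ {A B : Set} → (A → B) → Layer A → Layer B
map-layer g one        = one
map-layer g (stepL x)  = stepL (g x)
map-layer g (stepR x)  = stepR (g x)
map-layer g (two x)    = two (g x)
map-layer g (pair x y) = pair (g x) (g y)

-- Weights are numbers of edges, one less than the exponents of x. Hence x² C² adds 3: 2 for x², and
-- 1 because each of the two parts is one short but the whole only once.
weight : ∀ {A : Set} → (A → ℕ) → Layer A → ℕ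
weight w one        = 0
weight w (stepL x)  = 1 + w x
weight w (stepR x)  = 1 + w x
weight w (two x)    = 2 + w x
weight w (pair x y) = 3 + (w x + w y)

AllL : ∀ {A : Set} → (A → Set) → Layer A → Set
AllL Q one        = ⊤
AllL Q (stepL x)  = Q x
AllL Q (stepR x)  = Q x
AllL Q (two x)    = Q x
AllL Q (pair x y) = Q x × Q y

data Code : Set where
  ⟨_⟩ : Layer Code → Code

∣_∣ : Code → ℕ
∣ ⟨ one ⟩ ∣      = 0
∣ ⟨ stepL c ⟩ ∣  = 1 + ∣ c ∣
∣ ⟨ stepR c ⟩ ∣  = 1 + ∣ c ∣
∣ ⟨ two c ⟩ ∣    = 2 + ∣ c ∣
∣ ⟨ pair c d ⟩ ∣ = 3 + (∣ c ∣ + ∣ d ∣)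

-- The index of the first factor decides the summand: 1 gives 2 x C through its two elements, 2
-- gives x² C, and from 3 on the factor is a code itself, giving x² C².
toCode : ∀ {k} → Conv (3 + k) → Code
toCode a₃                        = ⟨ one ⟩
toCode (pair zero          a₁ y) = ⟨ stepL (toCode y) ⟩
toCode (pair zero          b₁ y) = ⟨ stepR (toCode y) ⟩
toCode (pair (suc zero)    a₂ y) = ⟨ two (toCode y) ⟩
toCode (pair (suc (suc i)) x  y) = ⟨ pair (toCode x) (toCode y) ⟩

∣toCode∣ : ∀ {k} (x : Conv (3 + k)) → ∣ toCode x ∣ ≡ k
∣toCode∣ a₃                        = refl
∣toCode∣ (pair zero          a₁ y) = cong suc (∣toCode∣ y)
∣toCode∣ (pair zero          b₁ y) = cong suc (∣toCode∣ y)
∣toCode∣ (pair {suc _} (suc zero) a₂ y) = cong (2 +_) (∣toCode∣ y)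
∣toCode∣ (pair {suc (suc m)} (suc (suc i)) x y) =
  cong (3 +_) (trans (cong₂ _+_ (∣toCode∣ x) (∣toCode∣ y)) (ℕ.m+[n∸m]≡n (ℕ.≤-pred (toℕ<n i))))

⟨⟩-injective : ∀ {x y} → ⟨ x ⟩ ≡ ⟨ y ⟩ → x ≡ y
⟨⟩-injective refl = refl

stepL-injective : ∀ {A : Set} {x y : A} → stepL x ≡ stepL y → x ≡ y
stepL-injective refl = refl

stepR-injective : ∀ {A : Set} {x y : A} → stepR x ≡ stepR y → x ≡ y
stepR-injective refl = refl

two-injective : ∀ {A : Set} {x y : A} → two x ≡ two y → x ≡ y
two-injective refl = refl

pair-injective : ∀ {A : Set} {x y x′ y′ : A} → Layer.pair x y ≡ pair x′ y′ → x ≡ x′ × y ≡ y′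
pair-injective refl = refl , refl

toCode-injective : ∀ {k} (x y : Conv (3 + k)) → toCode x ≡ toCode y → x ≡ y
toCode-injective a₃ a₃ _ = refl
toCode-injective (pair zero a₁ x) (pair zero a₁ y) e =
  cong (pair zero a₁) (toCode-injective x y (stepL-injective (⟨⟩-injective e)))
toCode-injective (pair zero b₁ x) (pair zero b₁ y) e =
  cong (pair zero b₁) (toCode-injective x y (stepR-injective (⟨⟩-injective e)))
toCode-injective (pair {suc _} (suc zero) a₂ x) (pair (suc zero) a₂ y) e =
  cong (pair (suc zero) a₂) (toCode-injective x y (two-injective (⟨⟩-injective e)))
toCode-injective (pair {suc (suc _)} (suc (suc i)) x x′) (pair (suc (suc j)) y y′) e
  with e₁ , e₂ ← pair-injective (⟨⟩-injective e)
  -- The weight of the first component is the split point; once the split points agree, the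
  -- components of the two pairs have the same types.
  with refl ← toℕ-injective (trans (sym (∣toCode∣ x)) (trans (cong ∣_∣ e₁) (∣toCode∣ y)))
  = cong₂ (pair (suc (suc i))) (toCode-injective x y e₁) (toCode-injective x′ y′ e₂)
toCode-injective (pair zero          a₁ _) (pair zero          b₁ _) ()
toCode-injective (pair zero          a₁ _) (pair (suc zero)    a₂ _) ()
toCode-injective (pair zero          a₁ _) (pair (suc (suc _)) _  _) ()
toCode-injective (pair zero          b₁ _) (pair zero          a₁ _) ()
toCode-injective (pair zero          b₁ _) (pair (suc zero)    a₂ _) ()
toCode-injective (pair zero          b₁ _) (pair (suc (suc _)) _  _) ()
toCode-injective (pair (suc zero)    a₂ _) (pair zero          a₁ _) ()
toCode-injective (pair (suc zero)    a₂ _) (pair zero          b₁ _) ()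
toCode-injective (pair (suc zero)    a₂ _) (pair (suc (suc _)) _  _) ()
toCode-injective (pair (suc (suc _)) _  _) (pair zero          a₁ _) ()
toCode-injective (pair (suc (suc _)) _  _) (pair zero          b₁ _) ()
toCode-injective (pair (suc (suc _)) _  _) (pair (suc zero)    a₂ _) ()

toCode-surjective : ∀ c {k} → ∣ c ∣ ≡ k → Σ[ x ∈ Conv (3 + k) ] toCode x ≡ c
toCode-surjective ⟨ one ⟩ refl = a₃ , refl
toCode-surjective ⟨ stepL c ⟩ refl =
  let x , e = toCode-surjective c refl in pair zero a₁ x , cong (⟨_⟩ ∘ stepL) e
toCode-surjective ⟨ stepR c ⟩ refl =
  let x , e = toCode-surjective c refl in pair zero b₁ x , cong (⟨_⟩ ∘ stepR) e
toCode-surjective ⟨ two c ⟩ refl =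
  let x , e = toCode-surjective c refl in pair (suc zero) a₂ x , cong (⟨_⟩ ∘ two) e
toCode-surjective ⟨ pair c d ⟩ refl =
  let x , e  = toCode-surjective c (sym toℕ-i)
      y , e′ = toCode-surjective d (sym (trans (cong (∣ c ∣ + ∣ d ∣ ∸_) toℕ-i) (ℕ.m+n∸m≡n ∣ c ∣ ∣ d ∣)))
  in pair (suc (suc i)) x y , cong₂ (λ c d → ⟨ pair c d ⟩) e e′
  where
  i : Fin (suc (∣ c ∣ + ∣ d ∣))
  i = fromℕ< (s≤s (m≤m+n ∣ c ∣ ∣ d ∣))

  toℕ-i : toℕ i ≡ ∣ c ∣
  toℕ-i = toℕ-fromℕ< _

-- One level of the grammar, carried out inside the good shapes. `parts` inverts `build` on every
-- layer, while the converse is asked of good shapes only, so `parts` may take default values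
-- elsewhere. Iterated by `fold` and `unfold`, this identifies the codes with the good shapes of the
-- same size.
record Decomposition (Good : Shape → Set) : Set where
  field
    build        : Layer Shape → Shape
    parts        : Shape → Layer Shape
    parts-build  : ∀ x → parts (build x) ≡ x
    ∥build∥      : ∀ x → ∥ build x ∥ ≡ weight ∥_∥ x
    good-build   : ∀ x → AllL Good x → Good (build x)
    good-parts   : ∀ s → Good s → build (parts s) ≡ s × AllL Good (parts s)

  fold : Code → Shape
  fold ⟨ one ⟩      = build one
  fold ⟨ stepL c ⟩  = build (stepL (fold c))
  fold ⟨ stepR c ⟩  = build (stepR (fold c))
  fold ⟨ two c ⟩    = build (two (fold c))
  fold ⟨ pair c d ⟩ = build (pair (fold c) (fold d))

  ∥fold∥ : ∀ c → ∥ fold c ∥ ≡ ∣ c ∣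
  ∥fold∥ ⟨ one ⟩      = ∥build∥ _
  ∥fold∥ ⟨ stepL c ⟩  = trans (∥build∥ _) (cong suc (∥fold∥ c))
  ∥fold∥ ⟨ stepR c ⟩  = trans (∥build∥ _) (cong suc (∥fold∥ c))
  ∥fold∥ ⟨ two c ⟩    = trans (∥build∥ _) (cong (2 +_) (∥fold∥ c))
  ∥fold∥ ⟨ pair c d ⟩ = trans (∥build∥ _) (cong₂ (λ i j → 3 + (i + j)) (∥fold∥ c) (∥fold∥ d))

  good-fold : ∀ c → Good (fold c)
  good-fold ⟨ one ⟩      = good-build _ tt
  good-fold ⟨ stepL c ⟩  = good-build _ (good-fold c)
  good-fold ⟨ stepR c ⟩  = good-build _ (good-fold c)
  good-fold ⟨ two c ⟩    = good-build _ (good-fold c)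
  good-fold ⟨ pair c d ⟩ = good-build _ (good-fold c , good-fold d)

  -- The first argument bounds the depth of the recursion.
  unfold : ℕ → Shape → Code
  -- A default, never reached from a good shape whose size is below the bound.
  unfold zero    s = ⟨ one ⟩
  unfold (suc k) s = ⟨ map-layer (unfold k) (parts s) ⟩

  unfold-fold : ∀ k c → ∣ c ∣ < k → unfold k (fold c) ≡ c
  unfold-fold (suc k) ⟨ one ⟩ _ rewrite parts-build one = refl
  unfold-fold (suc k) ⟨ stepL c ⟩ (s≤s c<k) rewrite parts-build (stepL (fold c)) =
    cong (⟨_⟩ ∘ stepL) (unfold-fold k c c<k)
  unfold-fold (suc k) ⟨ stepR c ⟩ (s≤s c<k) rewrite parts-build (stepR (fold c)) =
    cong (⟨_⟩ ∘ stepR) (unfold-fold k c c<k)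
  unfold-fold (suc k) ⟨ two c ⟩ (s≤s c<k) rewrite parts-build (two (fold c)) =
    cong (⟨_⟩ ∘ two) (unfold-fold k c (≤-trans (ℕ.n≤1+n _) c<k))
  unfold-fold (suc k) ⟨ pair c d ⟩ (s≤s cd<k) rewrite parts-build (pair (fold c) (fold d)) =
    cong₂ (λ c d → ⟨ pair c d ⟩)
      (unfold-fold k c (≤-trans (s≤s (≤-trans (m≤m+n _ _) (m≤n+m _ 2))) cd<k))
      (unfold-fold k d (≤-trans (s≤s (≤-trans (m≤n+m _ _) (m≤n+m _ 2))) cd<k))

  fold-unfold : ∀ k s → ∥ s ∥ < k → Good s → fold (unfold k s) ≡ s
  fold-unfold (suc k) s (s≤s s≤k) g =
    trans (layer (parts s) (proj₂ (good-parts s g)) small) (proj₁ (good-parts s g))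
    where
    small : weight ∥_∥ (parts s) ≤ k
    small = subst (_≤ k) (trans (sym (cong ∥_∥ (proj₁ (good-parts s g)))) (∥build∥ (parts s))) s≤k

    layer : ∀ x → AllL Good x → weight ∥_∥ x ≤ k → fold ⟨ map-layer (unfold k) x ⟩ ≡ build x
    layer one        _       _ = refl
    layer (stepL t)  g       <k = cong (build ∘ stepL) (fold-unfold k t <k g)
    layer (stepR t)  g       <k = cong (build ∘ stepR) (fold-unfold k t <k g)
    layer (two t)    g       <k = cong (build ∘ two) (fold-unfold k t (≤-trans (ℕ.n≤1+n _) <k) g)
    layer (pair t u) (g , h) <k = cong₂ (λ t u → build (pair t u))
      (fold-unfold k t (≤-trans (s≤s (≤-trans (m≤m+n _ _) (m≤n+m _ 2))) <k) g)
      (fold-unfold k u (≤-trans (s≤s (≤-trans (m≤n+m _ _) (m≤n+m _ 2))) <k) h)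

-- Counting the paths through codes

cardinality : ∀ {Z} (loc : Local Z) → Decomposition (Local.Good loc) → ∀ k →
              HasCardinality (paths k Z) (A025242 (3 + k))
cardinality {Z} loc dec k = record
  { to = to′ ; cong = λ { refl → refl } ; bijective = (λ {i} {j} → injective i j) , surjective }
  where
  open Local loc
  open Decomposition dec
  module I = Inverse (Fin↔Conv (3 + k))

  shapeOf : Fin (A025242 (3 + k)) → Shape
  shapeOf i = fold (toCode (I.to i))

  to′ : Fin (A025242 (3 + k)) → ℳ′ k Z
  to′ i = record
    { path    = word (shapeOf i)
    ; steps   = trans (length-word (shapeOf i)) (trans (∥fold∥ (toCode (I.to i))) (∣toCode∣ (I.to i)))
    ; motzkin = subst (MotzkinFrom 0) (++-identityʳ _) (word-motzkin (shapeOf i) end)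
    ; avoids  = from (avoids⇔good (shapeOf i)) (good-fold (toCode (I.to i)))
    }

  injective : ∀ i j → word (shapeOf i) ≡ word (shapeOf j) → i ≡ j
  injective i j e = trans (sym (I.strictlyInverseʳ i))
    (trans (cong I.from (toCode-injective _ _ code≡)) (I.strictlyInverseʳ j))
    where
    unfold-shapeOf : ∀ i → unfold (suc k) (shapeOf i) ≡ toCode (I.to i)
    unfold-shapeOf i = unfold-fold (suc k) _ (s≤s (≤-reflexive (∣toCode∣ (I.to i))))

    code≡ : toCode (I.to i) ≡ toCode (I.to j)
    code≡ = trans (sym (unfold-shapeOf i)) (trans (cong (unfold (suc k)) (word-injective e)) (unfold-shapeOf j))

  surjective : ∀ (p : ℳ′ k Z) → ∃[ i ] (∀ {j} → j ≡ i → word (shapeOf j) ≡ path p)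
  surjective p with s , refl ← motzkin-word (ℳ′.motzkin p) = I.from x , λ { refl → cong word (begin
      fold (toCode (I.to (I.from x))) ≡⟨ cong (fold ∘ toCode) (I.strictlyInverseˡ x) ⟩
      fold (toCode x)                 ≡⟨ cong fold (proj₂ c) ⟩
      fold (unfold (suc k) s)         ≡⟨ s≡ ⟩
      s                                      ∎) }
    where
    open ≡-Reasoning
    ∥s∥≡k : ∥ s ∥ ≡ k
    ∥s∥≡k = trans (sym (length-word s)) (ℳ′.steps p)

    s≡ : fold (unfold (suc k) s) ≡ s
    s≡ = fold-unfold (suc k) s (s≤s (≤-reflexive ∥s∥≡k)) (to (avoids⇔good s) (ℳ′.avoids p))

    -- The weight of the unfolded code is read off through `fold`, which returns `s` with its `k`
    -- edges.
    c : Σ[ x ∈ Conv (3 + k) ] toCode x ≡ unfold (suc k) s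
    c = toCode-surjective _ (trans (sym (∥fold∥ (unfold (suc k) s))) (trans (cong ∥_∥ s≡) ∥s∥≡k))

    x : Conv (3 + k)
    x = proj₁ c

-- Decompositions of the good shapes in the four cases

decomposition₁ : Decomposition (Local.Good local₁)
decomposition₁ = record
  { build = build ; parts = parts ; parts-build = parts-build ; ∥build∥ = ∥build∥
  ; good-build = good-build ; good-parts = good-parts }
  where
  open Local local₁

  build : Layer Shape → Shape
  build one        = •
  build (stepL s)  = L s
  build (stepR s)  = R s
  build (two s)    = LR s •
  build (pair s t) = LR s (L t)

  parts : Shape → Layer Shape
  parts •            = one
  parts (L s)        = stepL s
  parts (R s)        = stepR s
  parts (LR s •)     = two s
  parts (LR s (L t)) = pair s t
  -- A default: the right subtree of this root with two children has a right child, so the shape is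
  -- not good. The two clauses before leave `•` for x² C and `L t` for x² C².
  parts (LR _ _)     = one

  parts-build : ∀ x → parts (build x) ≡ x
  parts-build one        = refl
  parts-build (stepL _)  = refl
  parts-build (stepR _)  = refl
  parts-build (two _)    = refl
  parts-build (pair _ _) = refl

  ∥build∥ : ∀ x → ∥ build x ∥ ≡ weight ∥_∥ x
  ∥build∥ one        = refl
  ∥build∥ (stepL _)  = refl
  ∥build∥ (stepR _)  = refl
  ∥build∥ (two s)    = cong (2 +_) (+-identityʳ ∥ s ∥)
  ∥build∥ (pair s t) = cong (2 +_) (+-suc ∥ s ∥ ∥ t ∥)

  good-build : ∀ x → AllL Good x → Good (build x)
  good-build one        _       = tt
  good-build (stepL _)  g       = tt , g
  good-build (stepR _)  g       = tt , g
  good-build (two _)    g       = (tt , tt) , g , tt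
  good-build (pair _ _) (g , h) = (tt , tt) , g , (tt , h)

  good-parts : ∀ s → Good s → build (parts s) ≡ s × AllL Good (parts s)
  good-parts •            _                 = refl , tt
  good-parts (L _)        (_ , g)           = refl , g
  good-parts (R _)        (_ , g)           = refl , g
  good-parts (LR _ •)     (_ , g , _)       = refl , g
  good-parts (LR _ (L _)) (_ , g , (_ , h)) = refl , g , h

-- The mirrored restriction: of a vertex with two children, the left one may not have a left child,
-- which leaves `•` or `R s`.
decomposition₂ : Decomposition (Local.Good local₂)
decomposition₂ = record
  { build = build ; parts = parts ; parts-build = parts-build ; ∥build∥ = ∥build∥
  ; good-build = good-build ; good-parts = good-parts }
  where
  open Local local₂

  build : Layer Shape → Shape
  build one        = •
  build (stepL s)  = L s
  build (stepR s)  = R s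
  build (two s)    = LR • s
  build (pair s t) = LR (R s) t

  parts : Shape → Layer Shape
  parts •            = one
  parts (L s)        = stepL s
  parts (R s)        = stepR s
  parts (LR • s)     = two s
  parts (LR (R s) t) = pair s t
  parts (LR _ _)     = one

  parts-build : ∀ x → parts (build x) ≡ x
  parts-build one        = refl
  parts-build (stepL _)  = refl
  parts-build (stepR _)  = refl
  parts-build (two _)    = refl
  parts-build (pair _ _) = refl

  ∥build∥ : ∀ x → ∥ build x ∥ ≡ weight ∥_∥ x
  ∥build∥ one        = refl
  ∥build∥ (stepL _)  = refl
  ∥build∥ (stepR _)  = refl
  ∥build∥ (two _)    = refl
  ∥build∥ (pair _ _) = refl

  good-build : ∀ x → AllL Good x → Good (build x)
  good-build one        _       = tt
  good-build (stepL _)  g       = tt , g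
  good-build (stepR _)  g       = tt , g
  good-build (two _)    g       = (tt , tt) , tt , g
  good-build (pair _ _) (g , h) = (tt , tt) , (tt , g) , h

  good-parts : ∀ s → Good s → build (parts s) ≡ s × AllL Good (parts s)
  good-parts •            _                 = refl , tt
  good-parts (L _)        (_ , g)           = refl , g
  good-parts (R _)        (_ , g)           = refl , g
  good-parts (LR • _)     (_ , _ , g)       = refl , g
  good-parts (LR (R _) _) (_ , (_ , g) , h) = refl , g , h

-- Let A be the class of good shapes and N ⊆ A the class of those allowed as
-- right subtrees, so A = x (1 + A) (1 + N).  If N = x + x A + x N, the last
-- summand being the image of ext, then
--   A = x + x A + x N + x A (x + x A + x N)
--     = x + x A + x² A + x² A² + x (N + x A N),
-- and N + x A N = (x + x A + x N) + x A N = A.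

module Extension {Z} (loc : Local Z) where

  open Local loc

  -- `ext` identifies N with those members of N that have a right child; the others are `•` and the
  -- `L s` with `s` in A. Since `ext-hasRight` keeps the image apart from these, N = x + x A + x N
  -- is a disjoint union.
  module _
    (ext ext⁻ : Shape → Shape)
    (ext⁻-ext     : ∀ s → ext⁻ (ext s) ≡ s)
    (ext-hasRight : ∀ s → T (hasRight (ext s)))
    (∥ext∥        : ∀ s → ∥ ext s ∥ ≡ suc ∥ s ∥)
    (okFL         : ∀ s → T (ok FL s))
    (okD          : ∀ s → T (ok D s))
    (okFR         : ∀ s → ok FR s ≡ ok U s)
    (ok-•         : T (ok U •))
    (ok-L         : ∀ s → T (ok U (L s)))
    (good-ext     : ∀ s → T (ok U s) × Good s → T (ok U (ext s)) × Good (ext s))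
    (good-ext⁻    : ∀ s → T (hasRight s) → T (ok U s) × Good s →
                    ext (ext⁻ s) ≡ s × T (ok U (ext⁻ s)) × Good (ext⁻ s))
    where

    private
      build : Layer Shape → Shape
      build one              = •
      build (stepL s)        = L s
      -- `stepR` has to realise x A as x (N + x A N). Placed under `R`, the shapes `•`, `L s` and
      -- `R s` yield the three kinds of members of N, the last by `ext`; `LR s t` keeps its left
      -- subtree and has its right one extended.
      build (stepR •)        = R •
      build (stepR (L s))    = R (L s)
      build (stepR (R s))    = R (ext s)
      build (stepR (LR s t)) = LR s (ext t)
      build (two s)          = LR s •
      build (pair s t)       = LR s (L t)

      parts : Shape → Layer Shape
      parts •                    = one
      parts (L s)                = stepL s
      parts (R •)                = stepR •
      parts (R (L s))            = stepR (L s)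
      parts (R s@(R _))          = stepR (R (ext⁻ s))
      parts (R s@(LR _ _))       = stepR (R (ext⁻ s))
      parts (LR s •)             = two s
      parts (LR s (L t))         = pair s t
      parts (LR s t@(R _))       = stepR (LR s (ext⁻ t))
      parts (LR s t@(LR _ _))    = stepR (LR s (ext⁻ t))

      parts-R : ∀ s → T (hasRight s) → parts (R s) ≡ stepR (R (ext⁻ s))
      parts-R (R _)    _ = refl
      parts-R (LR _ _) _ = refl

      parts-LR : ∀ s t → T (hasRight t) → parts (LR s t) ≡ stepR (LR s (ext⁻ t))
      parts-LR _ (R _)    _ = refl
      parts-LR _ (LR _ _) _ = refl

      parts-build : ∀ x → parts (build x) ≡ x
      parts-build one              = refl
      parts-build (stepL _)        = refl
      parts-build (stepR •)        = refl
      parts-build (stepR (L _))    = refl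
      parts-build (stepR (R s))    = trans (parts-R (ext s) (ext-hasRight s)) (cong (stepR ∘ R) (ext⁻-ext s))
      parts-build (stepR (LR s t)) = trans (parts-LR s (ext t) (ext-hasRight t)) (cong (stepR ∘ LR s) (ext⁻-ext t))
      parts-build (two _)          = refl
      parts-build (pair _ _)       = refl

      ∥build∥ : ∀ x → ∥ build x ∥ ≡ weight ∥_∥ x
      ∥build∥ one              = refl
      ∥build∥ (stepL _)        = refl
      ∥build∥ (stepR •)        = refl
      ∥build∥ (stepR (L _))    = refl
      ∥build∥ (stepR (R s))    = cong suc (∥ext∥ s)
      ∥build∥ (stepR (LR s t)) = cong (2 +_) (trans (cong (∥ s ∥ +_) (∥ext∥ t)) (+-suc ∥ s ∥ ∥ t ∥))
      ∥build∥ (two s)          = cong (2 +_) (+-identityʳ ∥ s ∥)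
      ∥build∥ (pair s t)       = cong (2 +_) (+-suc ∥ s ∥ ∥ t ∥)

      good-R : ∀ s → Good (R s) ⇔ (T (ok U s) × Good s)
      good-R s rewrite okFR s = mk⇔ id id

      good-LR : ∀ {s t} → Good s → T (ok U t) × Good t → Good (LR s t)
      good-LR {s} g (o , h) = (o , okD s) , g , h

      good-build : ∀ x → AllL Good x → Good (build x)
      good-build one              _                 = tt
      good-build (stepL s)        g                 = okFL s , g
      good-build (stepR •)        _                 = from (good-R •) (ok-• , tt)
      good-build (stepR (L s))    g                 = from (good-R (L s)) (ok-L s , g)
      good-build (stepR (R s))    g                 = from (good-R (ext s)) (good-ext s (to (good-R s) g))
      good-build (stepR (LR s t)) ((o , _) , g , h) = good-LR g (good-ext t (o , h))
      good-build (two s)          g                 = good-LR g (ok-• , tt)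
      good-build (pair s t)       (g , h)           = good-LR g (ok-L t , okFL t , h)

      good-parts-R : ∀ s → T (hasRight s) → Good (R s) →
                     R (ext (ext⁻ s)) ≡ R s × Good (R (ext⁻ s))
      good-parts-R s r g =
        let e , g′ = good-ext⁻ s r (to (good-R s) g) in cong R e , from (good-R (ext⁻ s)) g′

      good-parts-LR : ∀ s t → T (hasRight t) → Good (LR s t) →
                      LR s (ext (ext⁻ t)) ≡ LR s t × Good (LR s (ext⁻ t))
      good-parts-LR s t r ((o , _) , g , h) =
        let e , h′ = good-ext⁻ t r (o , h) in cong (LR s) e , good-LR g h′

      good-parts : ∀ s → Good s → build (parts s) ≡ s × AllL Good (parts s)
      good-parts •               _                 = refl , tt
      good-parts (L _)           (_ , g)           = refl , g
      good-parts (R •)           _                 = refl , tt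
      good-parts (R (L _))       (_ , g)           = refl , g
      good-parts (R (R _))       g                 = good-parts-R _ tt g
      good-parts (R (LR _ _))    g                 = good-parts-R _ tt g
      good-parts (LR _ •)        (_ , g , _)       = refl , g
      good-parts (LR _ (L _))    (_ , g , (_ , h)) = refl , g , h
      good-parts (LR s (R _))    g                 = good-parts-LR s _ tt g
      good-parts (LR s (LR _ _)) g                 = good-parts-LR s _ tt g

    decomposition-ext : Decomposition Good
    decomposition-ext = record
      { build = build ; parts = parts ; parts-build = parts-build ; ∥build∥ = ∥build∥
      ; good-build = good-build ; good-parts = good-parts }

-- Here N consists of the good shapes whose root lacks a child. `R s` is good exactly if `s` is
-- again in N, so `ext` is `R` itself.
decomposition₃ : Decomposition (Local.Good local₃)
decomposition₃ = Extension.decomposition-ext local₃ R unR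
  (λ _ → refl) (λ _ → tt) (λ _ → refl) (λ _ → tt) (λ _ → tt) (λ _ → refl) tt (λ _ → tt)
  (λ s g → tt , g) good-unR
  where
  open Local local₃

  unR : Shape → Shape
  unR (R s) = s
  unR s     = s

  good-unR : ∀ s → T (hasRight s) → T (ok U s) × Good s → R (unR s) ≡ s × T (ok U (unR s)) × Good (unR s)
  good-unR (R s) _ (_ , g) = refl , g

decomposition₄ : Decomposition (Local.Good local₄)
decomposition₄ = Extension.decomposition-ext local₄ ext ext⁻
  ext⁻-ext ext-hasRight ∥ext∥ (λ _ → tt) (λ _ → tt) (λ _ → refl) tt (λ _ → tt) good-ext good-ext⁻
  where
  open Local local₄

  -- A shape that may be a right subtree is a left subtree with a chain of right
  -- children; ext lengthens the chain.
  ext ext⁻ : Shape → Shape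
  ext •        = R •
  ext (L s)    = LR s •
  ext (R s)    = R (R s)
  ext (LR s t) = LR s (R t)

  ext⁻ (R (R s))    = R s
  ext⁻ (LR s •)     = L s
  ext⁻ (LR s (R t)) = LR s t
  -- The right value for `R •`. The other shapes caught here have no right child, or a right child
  -- that has a left child, and so are not images under `ext` of members of N.
  ext⁻ _            = •

  ext⁻-ext : ∀ s → ext⁻ (ext s) ≡ s
  ext⁻-ext •        = refl
  ext⁻-ext (L _)    = refl
  ext⁻-ext (R _)    = refl
  ext⁻-ext (LR _ _) = refl

  ext-hasRight : ∀ s → T (hasRight (ext s))
  ext-hasRight •        = tt
  ext-hasRight (L _)    = tt
  ext-hasRight (R _)    = tt
  ext-hasRight (LR _ _) = tt

  ∥ext∥ : ∀ s → ∥ ext s ∥ ≡ suc ∥ s ∥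
  ∥ext∥ •        = refl
  ∥ext∥ (L s)    = cong (2 +_) (+-identityʳ ∥ s ∥)
  ∥ext∥ (R _)    = refl
  ∥ext∥ (LR s t) = cong (2 +_) (+-suc ∥ s ∥ ∥ t ∥)

  good-ext : ∀ s → T (ok U s) × Good s → T (ok U (ext s)) × Good (ext s)
  good-ext •        _                       = tt , tt , tt
  good-ext (L _)    (_ , _ , g)             = tt , (tt , tt) , g , tt
  good-ext (R _)    (o , g)                 = tt , o , g
  good-ext (LR _ _) (o , (o′ , _) , g , h)  = tt , (o , tt) , g , o′ , h

  good-ext⁻ : ∀ s → T (hasRight s) → T (ok U s) × Good s →
              ext (ext⁻ s) ≡ s × T (ok U (ext⁻ s)) × Good (ext⁻ s)
  good-ext⁻ (R •)        _ _                            = refl , tt , tt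
  good-ext⁻ (R (R _))    _ (_ , o , g)                  = refl , o , g
  good-ext⁻ (LR _ •)     _ (_ , _ , g , _)              = refl , tt , tt , g
  good-ext⁻ (LR _ (R _)) _ (_ , (o , _) , g , (o′ , h)) = refl , o , (o′ , tt) , g , h

-- Independence of the free entries

avoids-≐ : ∀ {k} (p q : Pattern k) {Q : 𝒯 n → Set} →
           (∀ T → Contains T p ⇔ Q T) → (∀ T → Contains T q ⇔ Q T) → Avoids n p ≐ Avoids n q
avoids-≐ _ _ p⇔ q⇔ =
  (λ {T} av c → av (from (p⇔ T) (to (q⇔ T) c))) , (λ {T} av c → av (from (q⇔ T) (to (p⇔ T) c)))

theorem12 : ((n : ℕ) → 1 ≤ n →
    ( f-Bijection n ⟨ P2134 ∣ true ∷ true ∷ true ∷ [] ⟩ Z₁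
    × f-Bijection n ⟨ P3214 ∣ true ∷ true ∷ true ∷ [] ⟩ Z₂
    × f-Bijection n ⟨ P1324 ∣ true ∷ true ∷ true ∷ [] ⟩ Z₃
    × f-Bijection n ⟨ P1243 ∣ true ∷ true ∷ true ∷ [] ⟩ Z₄
    )
    × ((x y : Bool) →
    Avoids n ⟨ P2134 ∣ true ∷ true ∷ true ∷ [] ⟩ ≐ Avoids n ⟨ P2134 ∣ x ∷ true ∷ y ∷ [] ⟩
    × Avoids n ⟨ P3214 ∣ true ∷ true ∷ true ∷ [] ⟩ ≐ Avoids n ⟨ P3214 ∣ true ∷ x ∷ y ∷ [] ⟩
    × Avoids n ⟨ P1324 ∣ true ∷ true ∷ true ∷ [] ⟩ ≐ Avoids n ⟨ P1324 ∣ true ∷ x ∷ y ∷ [] ⟩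
    × Avoids n ⟨ P1243 ∣ true ∷ true ∷ true ∷ [] ⟩ ≐ Avoids n ⟨ P1243 ∣ true ∷ x ∷ y ∷ [] ⟩
    )
    × ( HasCardinality (paths (pred n) Z₁) (A025242 (2 + n))
    × HasCardinality (paths (pred n) Z₂) (A025242 (2 + n))
    × HasCardinality (paths (pred n) Z₃) (A025242 (2 + n))
    × HasCardinality (paths (pred n) Z₄) (A025242 (2 + n))
    ))
    × (applyUpTo (λ i → A025242 (3 + i)) 10
    ≡ 1 ∷ 2 ∷ 5 ∷ 13 ∷ 35 ∷ 97 ∷ 275 ∷ 794 ∷ 2327 ∷ 6905 ∷ [])
theorem12 = (λ { (suc m) (s≤s z≤n) →
    ( Local.f-bijection local₁ (pattern₁ true true) (λ T → contains₁⇔occurs T true true)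
    , Local.f-bijection local₂ (pattern₂ true true) (λ T → contains₂⇔occurs T true true)
    , Local.f-bijection local₃ (pattern₃ true true) (λ T → contains₃⇔occurs T true true)
    , Local.f-bijection local₄ (pattern₄ true true) (λ T → contains₄⇔occurs T true true) )
  , (λ x y →
      avoids-≐ (pattern₁ true true) (pattern₁ x y)
        (λ T → contains₁⇔occurs T true true) (λ T → contains₁⇔occurs T x y)
    , avoids-≐ (pattern₂ true true) (pattern₂ x y)
        (λ T → contains₂⇔occurs T true true) (λ T → contains₂⇔occurs T x y)
    , avoids-≐ (pattern₃ true true) (pattern₃ x y)
        (λ T → contains₃⇔occurs T true true) (λ T → contains₃⇔occurs T x y)
    , avoids-≐ (pattern₄ true true) (pattern₄ x y)
        (λ T → contains₄⇔occurs T true true) (λ T → contains₄⇔occurs T x y) )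
  , ( cardinality local₁ decomposition₁ m
    , cardinality local₂ decomposition₂ m
    , cardinality local₃ decomposition₃ m
    , cardinality local₄ decomposition₄ m ) })
  , refl
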